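{- Let $k\geq 3$ be an integer and let $G$ be a 2-connected graph with minimum degree $\delta(G)\geq 2k+1$. Then $|L_e(G)|\geq k$. Moreover, if $|L_e(G)|=k$, then $2|L_e(G)|+2=\ell_e(G)$, and either $K_{2k+2}\subseteq G$ or $\chi(G)\leq 2k+1$.
   Context: All graphs are finite, simple and undirected. $L_e(G)$ denotes the set of all even integers $m$ such that $G$ contains a cycle of length $m$. $\ell_e(G)$ denotes the length of a longest even cycle in $G$ (when $G$ contains an even cycle). $\chi(G)$ is the chromatic number. $K_{m}\subseteq G$ means that $G$ contains a complete subgraph on $m$ vertices. -}

module Defs where

open import Data.Fin using (Fin; zero; suc)
open import Data.Fin.Properties using (injective⇒≤)
import Data.Fin.Properties as Fin
open import Data.Fin.Subset using (Subset; ∣_∣; _∈_; _∉_)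
open import Data.List using (List; _++_; take; length; map; filter; lookup; upTo; allFin)
open import Data.List.Extrema.Nat using (min; max)
open import Data.List.Membership.Propositional using () renaming (_∈_ to _∈ˡ_)
open import Data.List.Membership.Propositional.Properties using (∈-filter⁺; ∈-filter⁻; ∈-upTo⁺; ∈-lookup)
open import Data.List.Relation.Unary.All as All using (All)
open import Data.List.Relation.Unary.AllPairs using (_∷_)
open import Data.List.Relation.Unary.Linked using (Linked; linked?)
open import Data.List.Relation.Unary.Unique.Propositional using (Unique)
import Data.List.Relation.Unary.Unique.DecPropositional as DecUnique
open import Data.Nat using (ℕ; zero; suc; _≤_; _<_; s≤s; _≤?_)
open import Data.Nat.Divisibility using (_∣_; _∣?_)
open import Data.Product using (∃; _×_; _,_; proj₂)
open import Data.Vec using (Vec; []; _∷_; toList; fromList; tabulate)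
import Data.Vec as Vec
open import Data.Vec.Properties using (length-toList; toList∘fromList; lookup-allFin)
open import Function using (_∘_; _⇔_; mk⇔)
open import Level using (0ℓ)
open import Relation.Binary using (Rel; Irreflexive; Symmetric) renaming (Decidable to Decidable₂)
open import Relation.Binary.Construct.Closure.ReflexiveTransitive using (Star)
open import Relation.Binary.PropositionalEquality
  using (_≡_; _≢_; refl; sym; trans; cong; subst)
open import Relation.Nullary using (Dec; contradiction)
open import Relation.Nullary.Decidable using (does; map′; _×-dec_; _→-dec_; ¬?)
open import Relation.Unary using (Pred; Decidable)

private
  variable
    n : ℕ

record Graph (n : ℕ) : Set₁ where
  infix 4 _~_ _~?_
  field
    _~_     : Rel (Fin n) 0ℓ
    ~-irrefl : Irreflexive _≡_ _~_
    ~-sym   : Symmetric _~_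
    _~?_    : Decidable₂ _~_

module _ (G : Graph n) where
  open Graph G

  neighbours : Fin n → Subset n
  neighbours v = tabulate (λ u → does (v ~? u))

  degree : Fin n → ℕ
  degree v = ∣ neighbours v ∣

  -- Degrees are smaller than n, so the default value n is never attained
  -- when there is a vertex; the graph without vertices gets δ = 0.

  δ : ℕ
  δ = min n (map degree (allFin n))

  -- G − X is connected.  Non-emptiness of G − X is not required here; in
  -- KConnected it follows from the bound on ∣ X ∣.

  ConnectedWithout : Subset n → Set
  ConnectedWithout X = ∀ {u v} → u ∉ X → v ∉ X →
    Star (λ x y → x ∉ X × y ∉ X × x ~ y) u v

  KConnected : ℕ → Set
  KConnected k = k < n × (∀ (X : Subset n) → ∣ X ∣ < k → ConnectedWithout X)

  -- The list v₁ … vₘ of distinct vertices, m ≥ 3, traverses a cycle when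
  -- v₁ … vₘ v₁ is a walk.

  IsCycle : List (Fin n) → Set
  IsCycle vs = 3 ≤ length vs × Unique vs × Linked _~_ (vs ++ take 1 vs)

  HasCycle : ℕ → Set
  HasCycle m = ∃ λ vs → IsCycle vs × length vs ≡ m

  Lₑ : Pred ℕ 0ℓ
  Lₑ m = 2 ∣ m × HasCycle m

  Clique : Subset n → Set
  Clique S = ∀ {u v} → u ∈ S → v ∈ S → u ≢ v → u ~ v

  HasComplete : ℕ → Set
  HasComplete m = ∃ λ S → Clique S × ∣ S ∣ ≡ m

  Colourable : ℕ → Set
  Colourable c = ∃ λ (f : Vec (Fin c) n) → ∀ u v → u ~ v → Vec.lookup f u ≢ Vec.lookup f v

anyVec? : ∀ {m c} {P : Pred (Vec (Fin c) m) 0ℓ} → Decidable P → Dec (∃ P)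
anyVec? {zero}  P? = map′ ([] ,_) (λ { ([] , p) → p }) (P? [])
anyVec? {suc m} P? =
  map′ (λ { (x , xs , p) → x ∷ xs , p }) (λ { (x ∷ xs , p) → x , xs , p })
       (Fin.any? (λ x → anyVec? (λ xs → P? (x ∷ xs))))

module _ (G : Graph n) where
  open Graph G

  isCycle? : Decidable (IsCycle G)
  isCycle? vs =
    3 ≤? length vs ×-dec DecUnique.unique? Fin._≟_ vs ×-dec linked? _~?_ (vs ++ take 1 vs)

  hasCycle? : Decidable (HasCycle G)
  hasCycle? m =
    map′ (λ { (v , c) → toList v , c , length-toList v })
         (λ { (vs , c , refl) → fromList vs , subst (IsCycle G) (sym (toList∘fromList vs)) c })
         (anyVec? {m} (isCycle? ∘ toList))

  Lₑ? : Decidable (Lₑ G)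
  Lₑ? m = 2 ∣? m ×-dec hasCycle? m

  colourable? : Decidable (Colourable G)
  colourable? c = anyVec? λ f → Fin.all? λ u → Fin.all? λ v →
    (u ~? v) →-dec ¬? (Vec.lookup f u Fin.≟ Vec.lookup f v)

  -- The elements of Lₑ, without repetition.  A cycle has at most n vertices,
  -- so searching 0 … n finds all of them (∈-evenCycleLengths below).

  evenCycleLengths : List ℕ
  evenCycleLengths = filter Lₑ? (upTo (suc n))

  ∣Lₑ∣ : ℕ
  ∣Lₑ∣ = length evenCycleLengths

  -- The value is 0 if there is no even cycle.

  ℓₑ : ℕ
  ℓₑ = max 0 evenCycleLengths

  -- The least number of colours; n colours always suffice (colourable-n below).

  χ : ℕ
  χ = min n (filter colourable? (upTo n))

private
  lookup-injective : ∀ {A : Set} {xs : List A} → Unique xs →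
                     ∀ {i j} → lookup xs i ≡ lookup xs j → i ≡ j
  lookup-injective (_  ∷ _) {zero}  {zero}  _  = refl
  lookup-injective (x∉ ∷ _) {zero}  {suc j} eq = contradiction eq (All.lookup x∉ (∈-lookup j))
  lookup-injective (x∉ ∷ _) {suc i} {zero}  eq = contradiction (sym eq) (All.lookup x∉ (∈-lookup i))
  lookup-injective (_  ∷ u) {suc i} {suc j} eq = cong suc (lookup-injective u eq)

module _ (G : Graph n) where
  open Graph G

  ∈-evenCycleLengths : ∀ {m} → m ∈ˡ evenCycleLengths G ⇔ Lₑ G m
  ∈-evenCycleLengths = mk⇔
    (proj₂ ∘ ∈-filter⁻ (Lₑ? G) {xs = upTo (suc n)})
    (λ { l@(_ , _ , (_ , unique , _) , refl) →
         ∈-filter⁺ (Lₑ? G) (∈-upTo⁺ (s≤s (injective⇒≤ (lookup-injective unique)))) l })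

  colourable-n : Colourable G n
  colourable-n = Vec.allFin n , λ u v u~v eq →
    ~-irrefl (trans (sym (lookup-allFin u)) (trans eq (lookup-allFin v))) u~v

{-# OPTIONS --safe #-}

-- Let P = x₀ … xₘ be a longest path, chosen so that the largest neighbour
-- position t of x₀ is as large as possible.  Even cycles arise from edges
-- x_J ~ x_b, x₀ ~ x_z with J < b, z: x₀ … x_J x_b … x_z has 2 + J + |b − z|
-- vertices.  With J = 0 this confines the odd neighbour positions to 1 + S and
-- the even ones to s + S, where S = {0} ∪ (Lₑ − 2); hence |Lₑ| ≥ k.
--
-- If |Lₑ| = k, at most one of these 2k + 2 positions is missing, so S is closed
-- under subtraction and consists of the multiples of some d.  Every neighbour
-- position p gives another longest path x_{p−1} … x₀ x_p … xₘ (a rotation);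
-- for d > 2 the end of a suitable rotation has too few neighbours.  So
-- Lₑ = {4, …, 2k + 2}.  Rotations then show t ≤ 2k + 2 and that every vertex of
-- x₀ … x_{t−1} is the end of a longest path, so that all its neighbours are among
-- x₀ … x_t.  As x_t is not a cut vertex, n ≤ 2k + 3, and the complement of G is a
-- matching: if it has two edges, merging them gives a (2k + 1)-colouring, and
-- otherwise G contains K_{2k+2}.

module Submission where

open import Defs
open import Data.Nat using (ℕ; _+_; _*_; _≤_; _≥_)
open import Data.Product using (_×_)
open import Data.Sum using (_⊎_)
open import Relation.Binary.PropositionalEquality using (_≡_)

open import Data.Empty using (⊥; ⊥-elim)
open import Data.Fin using (Fin; punchOut; fromℕ<; toℕ)
import Data.Fin.Properties as Fin
open import Data.Fin.Subset as Subset using (Subset; ∣_∣; ⁅_⁆; _-_; inside; outside)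
import Data.Fin.Subset.Properties as Subset
open import Data.List using (List; []; _∷_; _++_; length; map; filter; upTo; applyUpTo; allFin)
-- Unambiguous names for the list constructors, in calls of the ring solver.
open import Data.List using () renaming (_∷_ to infixr 5 _⨾_; [] to ∎)
open import Data.List.Extrema.Nat using (min≤v⁺; min≤xs; max≤v⁺; v≤max⁺)
open import Data.List.Membership.Propositional using (_∈_)
open import Data.List.Membership.Propositional.Properties
open import Data.List.Properties using (length-applyUpTo; length-map; length-++; length-tabulate; filter-notAll)
open import Data.List.Relation.Unary.All as All using (All; []; _∷_)
open import Data.List.Relation.Unary.All.Properties using (¬All⇒Any¬)
open import Data.List.Relation.Unary.AllPairs using ([]; _∷_)
open import Data.List.Relation.Unary.Any as Any using (here; there)
open import Data.List.Relation.Unary.Linked using (Linked; [-]; _∷_)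
open import Data.List.Relation.Unary.Unique.Propositional using (Unique)
import Data.List.Relation.Unary.Unique.Propositional.Properties as Unique
open import Data.Nat using (zero; suc; pred; _<_; z≤n; s≤s; _∸_; _≟_; _≤?_; >-nonZero)
open import Data.Nat.Divisibility using (divides)
open import Data.Nat.Properties
open import Data.Nat.Tactic.RingSolver using (solve)
open import Data.Product using (∃; _,_; proj₁; proj₂)
open import Data.Sum using (inj₁; inj₂)
open import Data.Vec as Vec using (_∷_; here; there)
open import Data.Vec.Properties using (lookup∘tabulate; []=⇒lookup)
open import Function using (_∘_; id; Equivalence)
open import Level using (0ℓ)
open import Relation.Binary.Construct.Closure.ReflexiveTransitive using (Star; ε; _◅_)
open import Relation.Binary.PropositionalEquality
  using (_≢_; refl; sym; trans; cong; subst; subst₂)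
open import Relation.Nullary using (Dec; yes; no; ¬_; contradiction)
open import Relation.Nullary.Decidable using (_×-dec_; _⊎-dec_; ¬?; does; decidable-stable)
open import Relation.Unary using (Pred; Decidable)

-- Arithmetic, bounded search and counting

infixr 5 _⊕_
_⊕_ : ∀ {a b c d} → a ≤ b → c ≤ d → a + c ≤ b + d
_⊕_ = +-mono-≤

-- Linear arithmetic: A ≤ B is a sum of hypotheses, and c is the slack.
lin : ∀ {a b A B} c → A ≤ B → a + B + c ≡ b + A → a ≤ b
lin {a} {b} {A} {B} c A≤B eq = +-cancelʳ-≤ A a b
  (≤-trans (+-monoʳ-≤ a A≤B) (≤-trans (m≤m+n (a + B) c) (≤-reflexive eq)))

absurd : ∀ {A B} {X : Set} c → A ≤ B → A ≡ suc (B + c) → X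
absurd {A} {B} c A≤B refl = ⊥-elim (<-irrefl refl (≤-trans (s≤s (m≤m+n B c)) A≤B))

even⊎odd : ∀ i → (∃ λ a → i ≡ a * 2) ⊎ (∃ λ a → i ≡ suc (a * 2))
even⊎odd zero = inj₁ (0 , refl)
even⊎odd (suc i) with even⊎odd i
... | inj₁ (a , refl) = inj₂ (a , refl)
... | inj₂ (a , refl) = inj₁ (suc a , refl)

least : ∀ {Q : Pred ℕ 0ℓ} → Decidable Q → ∀ m → Q m → ∃ λ i → Q i × (∀ {j} → Q j → i ≤ j)
least Q? zero    q = 0 , q , λ _ → z≤n
least Q? (suc m) q with Q? 0
... | yes q₀ = 0 , q₀ , λ _ → z≤n
... | no ¬q₀ with least (Q? ∘ suc) m q
...   | i , qᵢ , min = suc i , qᵢ , λ { {zero} q₀ → contradiction q₀ ¬q₀ ; {suc j} qⱼ → s≤s (min qⱼ) }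

greatest : ∀ {Q : Pred ℕ 0ℓ} → Decidable Q → ∀ b → (∀ {j} → Q j → j ≤ b) → ∀ {i} → Q i →
           ∃ λ g → Q g × (∀ {j} → Q j → j ≤ g)
greatest Q? b ≤b q with Q? b
... | yes qb = b , qb , ≤b
greatest {Q} Q? zero ≤b q | no ¬q₀ = contradiction (subst Q (n≤0⇒n≡0 (≤b q)) q) ¬q₀
greatest Q? (suc b) ≤b q | no ¬qb = greatest Q? b (λ {j} qj → strict j qj) q
  where
  strict : ∀ j → _ → j ≤ b
  strict j qj with m≤n⇒m<n∨m≡n (≤b qj)
  ... | inj₁ (s≤s j≤b) = j≤b
  ... | inj₂ refl      = contradiction qj ¬qb

-- The double negation is harmless since the final conclusions are decidable.
¬¬-maximum : ∀ {a} {A : Set a} (f : A → ℕ) b → (∀ x → f x ≤ b) → A →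
             ¬ ¬ (∃ λ x → ∀ y → f y ≤ f x)
¬¬-maximum {A = A} f b f≤b x₀ none = climb (suc b) λ (x , b<fx) → <⇒≱ b<fx (f≤b x)
  where
  climb : ∀ i → ¬ ¬ (∃ λ x → i ≤ f x)
  climb zero    stuck = stuck (x₀ , z≤n)
  climb (suc i) stuck = climb i λ (x , i≤fx) →
    none (x , λ y → ≮⇒≥ λ fx<fy → stuck (y , ≤-<-trans i≤fx fx<fy))

∣p∣≤1+∣p-x∣ : ∀ {n} (p : Subset n) x → ∣ p ∣ ≤ suc ∣ (p - x) ∣
∣p∣≤1+∣p-x∣ (inside  ∷ p) Fin.zero    = s≤s (≤-reflexive (cong ∣_∣ (sym (Subset.p─⊥≡p p))))
∣p∣≤1+∣p-x∣ (outside ∷ p) Fin.zero    = m≤n⇒m≤1+n (≤-reflexive (cong ∣_∣ (sym (Subset.p─⊥≡p p))))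
∣p∣≤1+∣p-x∣ (inside  ∷ p) (Fin.suc x) = s≤s (∣p∣≤1+∣p-x∣ p x)
∣p∣≤1+∣p-x∣ (outside ∷ p) (Fin.suc x) = ∣p∣≤1+∣p-x∣ p x

x∉p-x : ∀ {n} (p : Subset n) x → x Subset.∉ p - x
x∉p-x (_ ∷ p) (Fin.suc x) (there x∈) = x∉p-x p x x∈

∣p∣≤length : ∀ {n} (p : Subset n) (xs : List (Fin n)) → (∀ {x} → x Subset.∈ p → x ∈ xs) → ∣ p ∣ ≤ length xs
∣p∣≤length {n} p [] p⊆xs = subst (∣ p ∣ ≤_) (Subset.∣⊥∣≡0 n)
  (Subset.p⊆q⇒∣p∣≤∣q∣ {q = Subset.⊥} λ x∈p → contradiction (p⊆xs x∈p) λ ())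
∣p∣≤length p (y ∷ xs) p⊆xs = ≤-trans (∣p∣≤1+∣p-x∣ p y) (s≤s (∣p∣≤length (p - y) xs rest))
  where
  rest : ∀ {x} → x Subset.∈ p - y → x ∈ xs
  rest x∈ with p⊆xs (Subset.p─q⊆p p ⁅ y ⁆ x∈)
  ... | here refl = contradiction x∈ (x∉p-x p y)
  ... | there x∈xs = x∈xs

Unique-⊆-length : ∀ {A : Set} {xs ys : List A} → Unique xs → (∀ {x} → x ∈ xs → x ∈ ys) →
                  length xs ≤ length ys
Unique-⊆-length [] _ = z≤n
Unique-⊆-length {xs = x ∷ xs} (x∉ ∷ u) xs⊆ys with ∈-∃++ (xs⊆ys (here refl))
... | as , bs , refl = ≤-trans (s≤s (Unique-⊆-length {ys = as ++ bs} u λ {y} y∈ → drop y∈ (∈-++⁻ as (xs⊆ys (there y∈)))))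
        (≤-reflexive (trans (cong suc (length-++ as)) (trans (sym (+-suc (length as) (length bs))) (sym (length-++ as)))))
  where
  drop : ∀ {y} → y ∈ xs → y ∈ as ⊎ y ∈ x ∷ bs → y ∈ as ++ bs
  drop _  (inj₁ y∈as)         = ∈-++⁺ˡ y∈as
  drop y∈ (inj₂ (here refl))  = contradiction refl (All.lookup x∉ y∈)
  drop _  (inj₂ (there y∈bs)) = ∈-++⁺ʳ as y∈bs

-- Both omitted elements can be put back in front of the filtered list without creating a
-- repetition.
two-missing : ∀ {A : Set} {P : Pred A 0ℓ} (P? : Decidable P) {xs : List A} → Unique xs →
  ∀ {x y} → x ∈ xs → y ∈ xs → x ≢ y → ¬ P x → ¬ P y → 2 + length (filter P? xs) ≤ length xs
two-missing P? {xs} u {x} {y} x∈ y∈ x≢y ¬px ¬py =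
  Unique-⊆-length ((x≢y ∷ apart ¬px) ∷ (apart ¬py ∷ Unique.filter⁺ P? u)) sub
  where
  apart : ∀ {z} → ¬ _ → All (z ≢_) (filter P? xs)
  apart ¬pz = All.tabulate λ { w∈ refl → ¬pz (proj₂ (∈-filter⁻ P? {xs = xs} w∈)) }
  sub : ∀ {z} → z ∈ x ∷ y ∷ filter P? xs → z ∈ xs
  sub (here refl)         = x∈
  sub (there (here refl)) = y∈
  sub (there (there z∈))  = proj₁ (∈-filter⁻ P? {xs = xs} z∈)

-- Paths and cycles

glue : ∀ {A : Set} → ℕ → (ℕ → A) → (ℕ → A) → ℕ → A
glue zero    f g i       = g i
glue (suc c) f g zero    = f zero
glue (suc c) f g (suc i) = glue c (f ∘ suc) g i

glue-low : ∀ {A : Set} c (f g : ℕ → A) {i} → i < c → glue c f g i ≡ f i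
glue-low (suc c) f g {zero}  _         = refl
glue-low (suc c) f g {suc i} (s≤s i<c) = glue-low c (f ∘ suc) g i<c

glue-high : ∀ {A : Set} c (f g : ℕ → A) j → glue c f g (c + j) ≡ g j
glue-high zero    f g j = refl
glue-high (suc c) f g j = glue-high c (f ∘ suc) g j

below⊎above : ∀ c i → i < c ⊎ (∃ λ j → i ≡ c + j)
below⊎above zero    i       = inj₂ (i , refl)
below⊎above (suc c) zero    = inj₁ (s≤s z≤n)
below⊎above (suc c) (suc i) with below⊎above c i
... | inj₁ i<c        = inj₁ (s≤s i<c)
... | inj₂ (j , refl) = inj₂ (j , refl)

Linked-applyUpTo-∷ʳ : ∀ {A : Set} {R : A → A → Set} (f : ℕ → A) m {c} →
  (∀ {i} → i < m → R (f i) (f (suc i))) → R (f m) c → Linked R (applyUpTo f (suc m) ++ c ∷ [])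
Linked-applyUpTo-∷ʳ f zero    step last = last ∷ [-]
Linked-applyUpTo-∷ʳ f (suc m) step last =
  step (s≤s z≤n) ∷ Linked-applyUpTo-∷ʳ (f ∘ suc) m (step ∘ s≤s) last

module _ {n} (G : Graph n) where
  open Graph G

  -- `m` counts edges. The values of `at` beyond `m` are arbitrary; a total function on `ℕ` makes
  -- reindexing free of bound proofs.
  record Path (m : ℕ) : Set where
    field
      at        : ℕ → Fin n
      injective : ∀ {i j} → i ≤ m → j ≤ m → at i ≡ at j → i ≡ j
      step      : ∀ {i} → i < m → at i ~ at (suc i)

  open Path

  path-short : ∀ {m} → Path m → m < n
  path-short {m} P = Fin.injective⇒≤ {f = at P ∘ toℕ {suc m}} λ {i} {j} eq →
    Fin.toℕ-injective (injective P (Fin.toℕ≤pred[n] i) (Fin.toℕ≤pred[n] j) eq)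

  close : ∀ {m} (P : Path m) → 2 ≤ m → at P 0 ~ at P m → HasCycle G (suc m)
  close {m} P 2≤m x₀~xₘ =
    applyUpTo (at P) (suc m) ,
    (subst (3 ≤_) (sym len) (s≤s 2≤m) ,
     Unique.applyUpTo⁺₁ (at P) (suc m) (λ i<j j<m eq →
       <⇒≢ i<j (injective P (≤-trans (<⇒≤ i<j) (≤-pred j<m)) (≤-pred j<m) eq)) ,
     Linked-applyUpTo-∷ʳ (at P) m (step P) (~-sym x₀~xₘ)) ,
    len
    where len = length-applyUpTo (at P) (suc m)

  -- The link is required only for an `i` with `suc i ≡ c`, so an empty first part needs no separate
  -- case.
  join : ∀ {c e} (f g : ℕ → Fin n) →
    (∀ {i j} → i < c → j < c → f i ≡ f j → i ≡ j) →
    (∀ {i j} → i ≤ e → j ≤ e → g i ≡ g j → i ≡ j) →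
    (∀ {i j} → i < c → j ≤ e → f i ≢ g j) →
    (∀ {i} → suc i < c → f i ~ f (suc i)) →
    (∀ {i} → suc i ≡ c → f i ~ g 0) →
    (∀ {i} → i < e → g i ~ g (suc i)) →
    Path (c + e)
  join {c} {e} f g f-inj g-inj f≢g f-step link g-step =
    record { at = glue c f g ; injective = inj ; step = stp }
    where
    low = glue-low c f g
    high = glue-high c f g
    inj : ∀ {i j} → i ≤ c + e → j ≤ c + e → glue c f g i ≡ glue c f g j → i ≡ j
    inj {i} {j} i≤ j≤ eq with below⊎above c i | below⊎above c j
    ... | inj₁ i<c | inj₁ j<c = f-inj i<c j<c (trans (sym (low i<c)) (trans eq (low j<c)))
    ... | inj₁ i<c | inj₂ (j′ , refl) = contradiction (trans (sym (low i<c)) (trans eq (high j′)))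
            (f≢g i<c (+-cancelˡ-≤ c j′ e j≤))
    ... | inj₂ (i′ , refl) | inj₁ j<c = contradiction (trans (sym (low j<c)) (trans (sym eq) (high i′)))
            (f≢g j<c (+-cancelˡ-≤ c i′ e i≤))
    ... | inj₂ (i′ , refl) | inj₂ (j′ , refl) = cong (c +_)
            (g-inj (+-cancelˡ-≤ c i′ e i≤) (+-cancelˡ-≤ c j′ e j≤) (trans (sym (high i′)) (trans eq (high j′))))
    stp : ∀ {i} → i < c + e → glue c f g i ~ glue c f g (suc i)
    stp {i} i< with below⊎above c i
    ... | inj₂ (i′ , refl) = subst₂ _~_ (sym (high i′))
            (trans (sym (high (suc i′))) (cong (glue c f g) (+-suc c i′)))
            (g-step (+-cancelˡ-< c i′ e i<))
    ... | inj₁ i<c with m≤n⇒m<n∨m≡n i<c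
    ...   | inj₁ 1+i<c = subst₂ _~_ (sym (low i<c)) (sym (low 1+i<c)) (f-step 1+i<c)
    ...   | inj₂ refl = subst₂ _~_ (sym (low i<c))
              (trans (sym (high 0)) (cong (glue c f g) (+-identityʳ c))) (link refl)

  -- The cycle x₀ … x_J x_b … x_z, where x_b … x_z runs up or down.
  theta-up : ∀ {m} (P : Path m) J b e → b + e ≤ m → J < b → 0 < J + e →
    at P J ~ at P b → at P 0 ~ at P (b + e) → HasCycle G (2 + (J + e))
  theta-up P J b e z≤m J<b 0<J+e J~b 0~z = close cyc (s≤s 0<J+e)
      (subst (at P 0 ~_) (sym (glue-high (suc J) (at P) g e)) 0~z)
    where
    g : ℕ → Fin n
    g i = at P (b + i)
    b≤ : ∀ {i} → i ≤ e → b + i ≤ _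
    b≤ i≤e = ≤-trans (+-monoʳ-≤ b i≤e) z≤m
    J≤ : ∀ {i} → i < suc J → i ≤ _
    J≤ (s≤s i≤J) = ≤-trans i≤J (≤-trans (<⇒≤ J<b) (m+n≤o⇒m≤o b z≤m))
    cyc : Path (suc J + e)
    cyc = join (at P) g
      (λ i< j< → injective P (J≤ i<) (J≤ j<))
      (λ i≤ j≤ eq → +-cancelˡ-≡ b _ _ (injective P (b≤ i≤) (b≤ j≤) eq))
      (λ { i<@(s≤s i≤J) j≤ eq → <⇒≢ (≤-<-trans i≤J (<-≤-trans J<b (m≤m+n b _))) (injective P (J≤ i<) (b≤ j≤) eq) })
      (λ { (s≤s i<J) → step P (<-≤-trans i<J (J≤ ≤-refl)) })
      (λ { refl → subst (λ i → at P J ~ at P i) (sym (+-identityʳ b)) J~b })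
      (λ {i} i<e → subst (λ j → at P (b + i) ~ at P j) (sym (+-suc b i))
        (step P (<-≤-trans (+-monoʳ-< b i<e) z≤m)))

  theta-down : ∀ {m} (P : Path m) J z e → z + e ≤ m → J < z → 0 < J + e →
    at P J ~ at P (z + e) → at P 0 ~ at P z → HasCycle G (2 + (J + e))
  theta-down {m} P J z e b≤m J<z 0<J+e J~b 0~z = close cyc (s≤s 0<J+e)
      (subst (at P 0 ~_) (sym (trans (glue-high (suc J) (at P) g e)
        (cong (at P) (trans (cong (z +_) (n∸n≡0 e)) (+-identityʳ z))))) 0~z)
    where
    g : ℕ → Fin n
    g i = at P (z + (e ∸ i))
    z≤ : ∀ i → z + (e ∸ i) ≤ m
    z≤ i = ≤-trans (+-monoʳ-≤ z (m∸n≤m e i)) b≤m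
    J≤ : ∀ {i} → i < suc J → i ≤ m
    J≤ (s≤s i≤J) = ≤-trans i≤J (≤-trans (<⇒≤ J<z) (m+n≤o⇒m≤o z b≤m))
    cyc : Path (suc J + e)
    cyc = join (at P) g
      (λ i< j< → injective P (J≤ i<) (J≤ j<))
      (λ {i} {j} i≤ j≤ eq → ∸-cancelˡ-≡ i≤ j≤ (+-cancelˡ-≡ z _ _ (injective P (z≤ i) (z≤ j) eq)))
      (λ { {j = j} i<@(s≤s i≤J) j≤ eq → <⇒≢ (≤-<-trans i≤J (<-≤-trans J<z (m≤m+n z _))) (injective P (J≤ i<) (z≤ j) eq) })
      (λ { (s≤s i<J) → step P (<-≤-trans i<J (J≤ ≤-refl)) })
      (λ { refl → J~b })
      (λ {i} i<e → ~-sym (subst (λ j → at P (z + (e ∸ suc i)) ~ at P j)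
        (trans (sym (+-suc z (e ∸ suc i))) (cong (z +_) (sym (+-∸-assoc 1 i<e))))
        (step P (subst (_≤ m) (trans (cong (z +_) (+-∸-assoc 1 i<e)) (+-suc z _)) (z≤ i)))))

  prepend : ∀ {m} v (P : Path m) → v ~ at P 0 → (∀ {i} → i ≤ m → at P i ≢ v) → Path (suc m)
  prepend v P v~x₀ v∉P = join {1} (λ _ → v) (at P) (λ { (s≤s z≤n) (s≤s z≤n) _ → refl }) (injective P)
    (λ _ j≤ eq → v∉P j≤ (sym eq)) (λ { (s≤s ()) }) (λ _ → v~x₀) (step P)

  rotate : ∀ {p e} (P : Path (p + e)) → at P 0 ~ at P p → Path (p + e)
  rotate {p} {e} P x₀~xₚ = join (λ i → at P (p ∸ suc i)) (λ i → at P (p + i))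
      (λ {i} {j} i<p j<p eq → suc-injective (∸-cancelˡ-≡ i<p j<p (injective P (low≤ i) (low≤ j) eq)))
      (λ i≤ j≤ eq → +-cancelˡ-≡ p _ _ (injective P (+-monoʳ-≤ p i≤) (+-monoʳ-≤ p j≤) eq))
      (λ {i} {j} i<p j≤ eq → <⇒≢ (<-≤-trans (∸-monoʳ-< (s≤s z≤n) i<p) (m≤m+n p j))
        (injective P (low≤ i) (+-monoʳ-≤ p j≤) eq))
      (λ {i} 1+i<p → ~-sym (subst (λ j → at P (p ∸ suc (suc i)) ~ at P j) (sym (+-∸-assoc 1 1+i<p))
         (step P (≤-trans (≤-reflexive (sym (+-∸-assoc 1 1+i<p))) (low≤ i)))))
      (λ { {i} refl → subst₂ (λ j k → at P j ~ at P k) (sym (n∸n≡0 i)) (sym (+-identityʳ p)) x₀~xₚ })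
      (λ {i} i<e → subst (λ j → at P (p + i) ~ at P j) (sym (+-suc p i)) (step P (+-monoʳ-< p i<e)))
    where
    low≤ : ∀ i → p ∸ suc i ≤ p + e
    low≤ i = ≤-trans (m∸n≤m p (suc i)) (m≤m+n p e)

-- Chords at the end of a path and the cycles they close

module _ {n} (G : Graph n) where
  open Graph G
  open Path

  ∈-neighbours⁻ : ∀ {v u} → u Subset.∈ neighbours G v → v ~ u
  ∈-neighbours⁻ {v} {u} u∈ with v ~? u | trans (sym (lookup∘tabulate (λ w → does (v ~? w)) u)) ([]=⇒lookup u∈)
  ... | yes v~u | _ = v~u

  -- The path edge to position 1 is included, so on a longest path the chords account for all
  -- neighbours of x₀.
  Chord : ∀ {m} → Path G m → ℕ → Set
  Chord {m} P i = i ≤ m × at P 0 ~ at P i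

  chord? : ∀ {m} (P : Path G m) → Decidable (Chord P)
  chord? {m} P i = i ≤? m ×-dec at P 0 ~? at P i

  chord-pos : ∀ {m} (P : Path G m) {i} → Chord P i → 0 < i
  chord-pos P {zero}  (_ , x₀~x₀) = contradiction x₀~x₀ (~-irrefl refl)
  chord-pos P {suc i} _           = s≤s z≤n

  chord-one : ∀ {m} (P : Path G m) {i} → Chord P i → Chord P 1
  chord-one P c = 1≤m , step P 1≤m
    where 1≤m = ≤-trans (chord-pos P c) (proj₁ c)

  -- These equations are all that is used of a rotation later. Writing `i + suc j ≡ p` instead of a
  -- subtraction lets `refl` settle concrete positions.
  record Rotated {m} (P : Path G m) (p : ℕ) : Set where
    field
      path : Path G m
      low  : ∀ {i} j → i + suc j ≡ p → at path i ≡ at P j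
      high : ∀ {i} → p ≤ i → at path i ≡ at P i

  rotation : ∀ {m} (P : Path G m) {p} → Chord P p → Rotated P p
  rotation P {p} (p≤m , x₀~xₚ) with m≤n⇒∃[o]m+o≡n p≤m
  ... | e , refl = record
    { path = rotate G {p} {e} P x₀~xₚ
    ; low  = λ {i} j eq → trans
        (glue-low p (λ i → at P (p ∸ suc i)) (λ i → at P (p + i))
          (≤-trans (m≤m+n (suc i) j) (≤-reflexive (trans (sym (+-suc i j)) eq))))
        (cong (at P) (trans (cong (_∸ suc i) (trans (sym eq) (+-suc i j))) (m+n∸m≡n (suc i) j)))
    ; high = λ {i} p≤i → subst (λ j → glue p (λ i → at P (p ∸ suc i)) (λ i → at P (p + i)) j ≡ at P j)
        (m+[n∸m]≡n p≤i) (glue-high p _ (λ i → at P (p + i)) (i ∸ p))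
    }

  -- The value 0 is admitted so that theta needs no side condition for a cycle
  -- degenerating to an edge.
  Short : ℕ → Set
  Short f = f ≡ 0 ⊎ Lₑ G (2 + f)

  short? : Decidable Short
  short? f = f ≟ 0 ⊎-dec Lₑ? G (2 + f)

  even-length : ∀ {x} → Lₑ G x → ∃ λ q → x ≡ 2 + suc q * 2 × Short (suc q * 2)
  even-length (divides zero refl , vs , (3≤ , _) , eq) = contradiction (subst (3 ≤_) eq 3≤) λ ()
  even-length (divides (suc zero) refl , vs , (3≤ , _) , eq) = contradiction (subst (3 ≤_) eq 3≤) λ { (s≤s (s≤s ())) }
  even-length l@(divides (suc (suc q)) refl , _) = q , refl , inj₂ l

  short-length : ∀ {q} → Short (suc q * 2) → Lₑ G (2 + suc q * 2)
  short-length (inj₂ l) = l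

  short-bound : ∀ {f} → Short f → f ≤ n
  short-bound (inj₁ refl) = z≤n
  short-bound (inj₂ l) = ≤-trans (m≤n+m _ 2) (≤-pred (∈-upTo⁻ (proj₁
    (∈-filter⁻ (Lₑ? G) {xs = upTo (suc n)} (Equivalence.from (∈-evenCycleLengths G) l)))))

  -- The segment between x_b and x_z has `e` edges; the disjunction records its direction. All even
  -- cycles constructed in the proof come from here.
  theta : ∀ {m} (P : Path G m) {J b z} e → b ≤ m → z ≤ m → J < b → J < z →
          at P J ~ at P b → at P 0 ~ at P z → (z + e ≡ b ⊎ b + e ≡ z) →
          ∀ q → J + e ≡ q * 2 → Short (q * 2)
  theta P {J} e b≤m z≤m J<b J<z J~b 0~z rel zero eq = inj₁ refl
  theta P {J} e b≤m z≤m J<b J<z J~b 0~z rel (suc q) eq =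
    inj₂ (divides (2 + q) refl , subst (HasCycle G) (cong (2 +_) eq) (cyc rel))
    where
    pos = ≤-trans (s≤s z≤n) (≤-reflexive (sym eq))
    cyc : _ → HasCycle G (2 + (J + e))
    cyc (inj₁ refl) = theta-down G P J _ e b≤m J<z pos J~b 0~z
    cyc (inj₂ refl) = theta-up G P J _ e z≤m J<b pos J~b 0~z

  -- This is `theta` with `J = 0`: both edges leave x₀, and the path segment between their ends
  -- closes the cycle.
  chord-difference : ∀ {m} (P : Path G m) {i} q → Chord P i → Chord P (i + q * 2) → Short (q * 2)
  chord-difference P q c@(i≤m , 0~i) c′@(j≤m , 0~j) =
    theta P (q * 2) i≤m j≤m (chord-pos P c) (chord-pos P c′) 0~i 0~j (inj₂ refl) q refl

  short-odd : ∀ {m} (P : Path G m) q → Chord P (suc (q * 2)) → Short (q * 2)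
  short-odd P q c = chord-difference P q (chord-one P c) c

  -- The set S of the overview, as a list.
  shorts : List ℕ
  shorts = 0 ∷ map (_∸ 2) (evenCycleLengths G)

  length-shorts : length shorts ≡ suc (∣Lₑ∣ G)
  length-shorts = cong suc (length-map (_∸ 2) (evenCycleLengths G))

  ∈-shorts⁺ : ∀ {f} → Short f → f ∈ shorts
  ∈-shorts⁺ (inj₁ refl) = here refl
  ∈-shorts⁺ (inj₂ l)    = there (∈-map⁺ (_∸ 2) (Equivalence.from (∈-evenCycleLengths G) l))

  -- Counting the neighbours of an end of a longest path by parity

  module Longest {m} (longest : ∀ {m′} → Path G m′ → m′ ≤ m)
                 k (deg : ∀ v → 2 * k + 1 ≤ degree G v)
                 l (∣Lₑ∣≡l : ∣Lₑ∣ G ≡ l) where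

    -- A neighbour off the path could be prepended, giving a longer path.
    neighbour-on-path : ∀ (P : Path G m) {v} → at P 0 ~ v → ∃ λ i → Chord P i × at P i ≡ v
    neighbour-on-path P {v} x₀~v with anyUpTo? (λ i → at P i Fin.≟ v) (suc m)
    ... | yes (i , s≤s i≤m , refl) = i , (i≤m , x₀~v) , refl
    ... | no  v∉P = contradiction (longest (prepend G v P (~-sym x₀~v) λ i≤m eq → v∉P (_ , s≤s i≤m , eq))) (<-irrefl refl)

    degree-bound : ∀ (P : Path G m) (W : List ℕ) → (∀ {i} → Chord P i → i ∈ W) → 2 * k + 1 ≤ length W
    degree-bound P W cover = ≤-trans (deg (at P 0)) (≤-trans
      (∣p∣≤length (neighbours G (at P 0)) (map (at P) W) covered) (≤-reflexive (length-map (at P) W)))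
      where
      covered : ∀ {v} → v Subset.∈ neighbours G (at P 0) → v ∈ map (at P) W
      covered v∈ with neighbour-on-path P (∈-neighbours⁻ v∈)
      ... | i , c , refl = ∈-map⁺ (at P) (cover c)

    parity-bound : ∀ (P : Path G m) {u w} U W → length U ≤ u → length W ≤ w →
      (∀ a → Chord P (suc (a * 2)) → suc (a * 2) ∈ U) → (∀ a → Chord P (a * 2) → a * 2 ∈ W) →
      2 * k + 1 ≤ u + w
    parity-bound P U W |U| |W| odd even =
      ≤-trans (degree-bound P (U ++ W) cover) (≤-trans (≤-reflexive (length-++ U)) (+-mono-≤ |U| |W|))
      where
      cover : ∀ {i} → Chord P i → i ∈ U ++ W
      cover {i} c with even⊎odd i
      ... | inj₁ (a , refl) = ∈-++⁺ʳ U (even a c)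
      ... | inj₂ (a , refl) = ∈-++⁺ˡ (odd a c)

    odds : List ℕ
    odds = map suc shorts

    length-odds : length odds ≡ suc l
    length-odds = trans (length-map suc shorts) (trans length-shorts (cong suc ∣Lₑ∣≡l))

    odd-cover : ∀ (P : Path G m) a → Chord P (suc (a * 2)) → suc (a * 2) ∈ odds
    odd-cover P a c = ∈-map⁺ suc (∈-shorts⁺ (short-odd P a c))

    -- Among the odd positions 1 always serves as base. No even position is guaranteed; the least
    -- one, if any, is the base `b * 2`.
    EvenChords : Path G m → Set
    EvenChords P = (∀ a → ¬ Chord P (a * 2)) ⊎
                   (∃ λ b → Chord P (b * 2) × (∀ a → Chord P (a * 2) → b ≤ a))

    evenChords : ∀ P → EvenChords P
    evenChords P with anyUpTo? (λ a → chord? P (a * 2)) (suc m)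
    ... | yes (a , _ , c) = inj₂ (let b , cb , b≤ = least (λ a → chord? P (a * 2)) a c in b , cb , λ _ → b≤)
    ... | no none = inj₁ λ a c → none (a , s≤s (≤-trans (m≤m*n a 2) (proj₁ c)) , c)

    evens : ℕ → List ℕ
    evens b = map (b * 2 +_) shorts

    length-evens : ∀ b → length (evens b) ≡ suc l
    length-evens b = trans (length-map (b * 2 +_) shorts) (trans length-shorts (cong suc ∣Lₑ∣≡l))

    even-difference : ∀ (P : Path G m) b r → Chord P (b * 2) → Chord P ((b + r) * 2) → Short (r * 2)
    even-difference P b r cb ca =
      chord-difference P {b * 2} r cb (subst (Chord P) (*-distribʳ-+ 2 b r) ca)

    even-cover : ∀ (P : Path G m) b → Chord P (b * 2) → ∀ a → b ≤ a → Chord P (a * 2) → a * 2 ∈ evens b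
    even-cover P b cb a b≤a ca with m≤n⇒∃[o]m+o≡n b≤a
    ... | r , refl = subst (_∈ evens b) (sym (*-distribʳ-+ 2 b r))
                       (∈-map⁺ (b * 2 +_) (∈-shorts⁺ (even-difference P b r cb ca)))

    even-cover-list : ∀ (P : Path G m) → ∃ λ W → length W ≤ suc l × (∀ a → Chord P (a * 2) → a * 2 ∈ W)
    even-cover-list P with evenChords P
    ... | inj₁ none         = [] , z≤n , λ a c → contradiction c (none a)
    ... | inj₂ (b , cb , b≤) = evens b , ≤-reflexive (length-evens b) , λ a c → even-cover P b cb a (b≤ a c) c

    enough : Path G m → k ≤ l
    enough P with even-cover-list P
    -- Each parity contributes at most `l + 1` positions, so `2k + 1 ≤ 2(l + 1)`, which is
    -- `2k < 2(l + 1)`.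
    ... | W , |W| , cover = ≤-pred (*-cancelˡ-< 2 k (suc l) (lin 0
            (parity-bound P odds W (≤-reflexive length-odds) |W| (odd-cover P) cover) (solve (k ⨾ l ⨾ ∎))))

    -- The case `|Lₑ| = k`: closure of S under subtraction

    module Extremal (k≥3 : 3 ≤ k) (l≡k : l ≡ k) where

      -- The even positions number at most `k + 1`, and `2 + (k + 1) < 2k + 1` because `k ≥ 3`.
      few-odds : ∀ (P : Path G m) U → length U ≤ 2 → ¬ (∀ a → Chord P (suc (a * 2)) → suc (a * 2) ∈ U)
      few-odds P U |U| odd with even-cover-list P
      ... | W , |W| , even = absurd 0
              (parity-bound P U W |U| |W| odd even ⊕ ≤-reflexive l≡k ⊕ k≥3) (solve (k ⨾ l ⨾ ∎))

      few-evens : ∀ (P : Path G m) W → length W ≤ 2 → ¬ (∀ a → Chord P (a * 2) → a * 2 ∈ W)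
      few-evens P W |W| even = absurd 0
        (parity-bound P odds W (≤-reflexive length-odds) |W| (odd-cover P) even ⊕ ≤-reflexive l≡k ⊕ k≥3)
        (solve (k ⨾ l ⨾ ∎))

      OddFull EvenFull : Path G m → Set
      OddFull  P = ∀ {f} → Short f → Chord P (suc f)
      EvenFull P = ∃ λ b → Chord P (b * 2) × (∀ {f} → Short f → Chord P (b * 2 + f))

      -- The degree allows at most one of the `2k + 2` candidates in `odds` and `evens b` to be
      -- missing, so one of the two classes is complete.
      full : ∀ P → OddFull P ⊎ EvenFull P
      full P with All.all? (chord? P) odds
      ... | yes all = inj₁ λ s → All.lookup all (∈-map⁺ suc (∈-shorts⁺ s))
      ... | no ¬odds with evenChords P
      ...   | inj₁ none = absurd 2
                (parity-bound P {w = 0} odds [] (≤-reflexive length-odds) z≤n (odd-cover P) (λ a c → contradiction c (none a))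
                 ⊕ ≤-reflexive l≡k ⊕ k≥3) (solve (k ⨾ l ⨾ ∎))
      ...   | inj₂ (b , cb , b≤) with All.all? (chord? P) (evens b)
      ...     | yes all = inj₂ (b , cb , λ s → All.lookup all (∈-map⁺ (b * 2 +_) (∈-shorts⁺ s)))
      ...     | no ¬evens = absurd 0
                (parity-bound P (filter (chord? P) odds) (filter (chord? P) (evens b))
                  (≤-pred (≤-trans (filter-notAll (chord? P) odds (¬All⇒Any¬ (chord? P) odds ¬odds))
                    (≤-reflexive length-odds)))
                  (≤-pred (≤-trans (filter-notAll (chord? P) (evens b) (¬All⇒Any¬ (chord? P) (evens b) ¬evens))
                    (≤-reflexive (length-evens b))))
                  (λ a c → ∈-filter⁺ (chord? P) (odd-cover P a c) c)
                  (λ a c → ∈-filter⁺ (chord? P) (even-cover P b cb a (b≤ a c) c) c)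
                 ⊕ ≤-reflexive l≡k ⊕ ≤-reflexive l≡k) (solve (k ⨾ l ⨾ ∎))

      HalfShort : ℕ → Set
      HalfShort q = Short (q * 2)

      -- In a complete class the positions belonging to `q` and to `q + r` are both chords, and they
      -- lie `2r` apart.
      halfShort-∸ : Path G m → ∀ q r → HalfShort q → HalfShort (q + r) → HalfShort r
      halfShort-∸ P q r sq sqr with full P
      ... | inj₁ odd = chord-difference P {suc (q * 2)} r (odd sq)
                         (subst (Chord P ∘ suc) (*-distribʳ-+ 2 q r) (odd sqr))
      ... | inj₂ (b , _ , even) = chord-difference P {b * 2 + q * 2} r (even sq)
              (subst (Chord P) (trans (cong (b * 2 +_) (*-distribʳ-+ 2 q r)) (sym (+-assoc (b * 2) (q * 2) (r * 2))))
                (even sqr))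

      shortEven : ∃ λ q → HalfShort (suc q)
      shortEven with member (evenCycleLengths G)
          (≤-trans (s≤s z≤n) (≤-trans k≥3 (≤-reflexive (trans (sym l≡k) (sym ∣Lₑ∣≡l)))))
        where
        member : ∀ xs → 1 ≤ length xs → ∃ λ x → x ∈ xs
        member (x ∷ xs) _ = x , here refl
      ... | x , x∈ with even-length (Equivalence.to (∈-evenCycleLengths G {m = x}) x∈)
      ...   | q , refl , s = q , s

-- Consecutive even cycle lengths

module _ {n} (G : Graph n) {m} (longest : ∀ {m′} → Path G m′ → m′ ≤ m)
         k (k≥3 : 3 ≤ k) (deg : ∀ v → 2 * k + 1 ≤ degree G v)
         l (∣Lₑ∣≡l : ∣Lₑ∣ G ≡ l) (l≡k : l ≡ k) where
  open Graph G
  open Path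
  open Longest G longest k deg l ∣Lₑ∣≡l
  open Extremal k≥3 l≡k
  module Tight {t} (P : Path G m) (tight : Chord G P t)
               (tmax : ∀ (Q : Path G m) {i} → Chord G Q i → i ≤ t) where

    -- Lengths are halved: the common difference is d = 2 (c′ + 1), and the largest
    -- even cycle has length 2 + 2 E.
    module Progression c′ (sc : HalfShort (suc c′)) (c-min : ∀ q → HalfShort (suc q) → c′ ≤ q)
                       E (sE : HalfShort E) (E-max : ∀ q → HalfShort q → q ≤ E) where

      -- Subtraction puts `c′` into the halved S, whose least positive element is `c′ + 1`.
      finish : ∀ g → HalfShort (suc g) → HalfShort (suc (g + c′)) → c′ ≡ 0
      finish g sg sgc = go c′ refl
        where
        go : ∀ x → c′ ≡ x → c′ ≡ 0
        go zero    eq = eq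
        go (suc x) eq = contradiction
          (subst (_≤ x) eq (c-min x (subst HalfShort eq (halfShort-∸ P (suc g) c′ sg sgc)))) (<-irrefl refl)

      -- Rotate at the last odd position `2E + 1`. If `c′` were positive, the new end x_{2E} would
      -- keep only the odd positions `1` and `2E + 1`.
      oddCase : OddFull P → c′ ≡ 0
      oddCase odd with c′ ≟ 0
      ... | yes c′≡0 = c′≡0
      ... | no  c′≢0 = contradiction cover (few-odds R (1 ∷ suc (E * 2) ∷ []) ≤-refl)
        where
        open Rotated (rotation G P (odd sE)) renaming (path to R)
        claim : ∀ a′ g′ → E ≡ suc a′ + suc g′ → ¬ Chord G R (suc (suc a′ * 2))
        claim a′ g′ E≡ c with m≤n⇒∃[o]m+o≡n
            (c-min g′ (halfShort-∸ P (suc a′) (suc g′) (short-odd G R (suc a′) c) (subst HalfShort E≡ sE)))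
        ... | h , refl =
            -- In P the chord of R is the edge x_J x_b. As `E − (c′ + 1)` is in the halved S,
            -- `z = b − (2c′ + 1)` is a chord of P, and the cycle through x_z yields `g + 1 + c′`.
            -- Subtraction from `E` yields `g + 1`.
            let g = c′ + h
                sg = halfShort-∸ P (suc a′) (suc g) (short-odd G R (suc a′) c) (subst HalfShort E≡ sE)
                J = suc (g * 2)
                b = E * 2
                z = suc ((suc a′ + h) * 2)
                e = suc (c′ * 2)
                b≡ : b ≡ (suc a′ + suc (c′ + h)) * 2
                b≡ = cong (_* 2) E≡
                E≡′ : suc a′ + suc (c′ + h) ≡ suc c′ + (suc a′ + h)
                E≡′ = solve (c′ ⨾ h ⨾ a′ ⨾ ∎)
                J-end : suc (suc a′ * 2) + suc J ≡ suc ((suc a′ + suc (c′ + h)) * 2)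
                J-end = solve (c′ ⨾ h ⨾ a′ ⨾ ∎)
                zc : Chord G P z
                zc = odd (halfShort-∸ P (suc c′) (suc a′ + h) sc (subst HalfShort (trans E≡ E≡′) sE))
                c′≤a′ = c-min a′ (short-odd G R (suc a′) c)
                J<b : J < (suc a′ + suc (c′ + h)) * 2
                J<b = lin (a′ * 2 + 2) (z≤n {0}) (solve (c′ ⨾ h ⨾ a′ ⨾ ∎))
                J<z : J < z
                J<z = lin 1 (c′≤a′ ⊕ c′≤a′) (solve (c′ ⨾ h ⨾ a′ ⨾ ∎))
                z+e : z + e ≡ (suc a′ + suc (c′ + h)) * 2
                z+e = solve (c′ ⨾ h ⨾ a′ ⨾ ∎)
                J+e : J + e ≡ suc (g + c′) * 2
                J+e = solve (c′ ⨾ h ⨾ ∎)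
                J~b : at P J ~ at P b
                J~b = ~-sym (subst₂ _~_ (low {0} b refl) (low J (trans J-end (cong suc (sym b≡)))) (proj₂ c))
            in c′≢0 (finish g sg (theta G P {J} {b} {z} e (≤-trans (n≤1+n b) (proj₁ (odd sE))) (proj₁ zc)
                 (subst (J <_) (sym b≡) J<b) J<z J~b (proj₂ zc) (inj₁ (trans z+e (sym b≡))) (suc (g + c′)) J+e))
        cover : ∀ a → Chord G R (suc (a * 2)) → suc (a * 2) ∈ 1 ∷ suc (E * 2) ∷ []
        cover zero _ = here refl
        cover (suc a′) c with m≤n⇒m<n∨m≡n (E-max (suc a′) (short-odd G R (suc a′) c))
        ... | inj₂ refl = there (here refl)
        ... | inj₁ a<E with m≤n⇒∃[o]m+o≡n a<E
        ...   | g′ , eq = contradiction c (claim a′ g′ (trans (sym eq) (sym (+-suc (suc a′) g′))))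

      -- Rotate at `t`, making x_{t-1} the end. If `c′` were positive, an even position `2a` would
      -- have `a ≤ c′` or `a = b + E`. Two positions of the first kind would be too close together,
      -- so at most two even positions remain.
      evenCase : EvenFull P → c′ ≡ 0
      evenCase (b , cb , even) with c′ ≟ 0
      ... | yes c′≡0 = c′≡0
      ... | no  c′≢0 = contradiction cover (few-evens R W W≤2)
        where
        cE : Chord G P (b * 2 + E * 2)
        cE = even sE
        -- An odd position is at most `2E + 1`, which is less than the chord `2b + 2E`. So `t` is
        -- even and is the last element of `2b + S`.
        t≡ : t ≡ (b + E) * 2
        t≡ with even⊎odd t
        ... | inj₂ (a , eq) = absurd 0 (tmax P cE ⊕ ≤-reflexive eq ⊕ aE ⊕ aE ⊕ b>0 ⊕ b>0) (solve (b ⨾ E ⨾ a ⨾ t ⨾ ∎))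
          where aE = E-max a (short-odd G P a (subst (Chord G P) eq tight))
                b>0 : 1 ≤ b
                b>0 = *-cancelʳ-< 2 0 b (chord-pos G P cb)
        ... | inj₁ (a , refl) with m≤n⇒∃[o]m+o≡n {b} {a} (*-cancelʳ-≤ b a 2 (m+n≤o⇒m≤o (b * 2) (tmax P cE)))
        ...   | r , refl = cong (λ x → (b + x) * 2) (≤-antisym (E-max r (even-difference P b r cb tight))
                  (+-cancelˡ-≤ b E r (*-cancelʳ-≤ (b + E) (b + r) 2
                    (subst (_≤ (b + r) * 2) (sym (*-distribʳ-+ 2 b E)) (tmax P cE)))))
        open Rotated (rotation G P tight) renaming (path to R)
        claim : ∀ h g → b + E ≡ (suc c′ + h) + suc g → ¬ Chord G R ((suc c′ + h) * 2)
        claim h g eq c with m≤n⇒∃[o]m+o≡n {suc c′} {E} (E-max (suc c′) sc)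
        ... | r , refl =
          -- In P the chord of R joins x_J to x_{t-1}. Closing it through `z = t − 2(c′ + 1)` yields
          -- `g + 1 + c′`; closing it through x_t yields `g + 1`.
          let J = suc (g * 2)
              Y = suc ((suc c′ + h + g) * 2)
              z = (h + suc g) * 2
              t≡′ : t ≡ (suc c′ + h + suc g) * 2
              t≡′ = trans t≡ (cong (_* 2) eq)
              Y-end : suc Y ≡ (suc c′ + h + suc g) * 2
              Y-end = solve (c′ ⨾ h ⨾ g ⨾ ∎)
              J-end : (suc c′ + h) * 2 + suc J ≡ (suc c′ + h + suc g) * 2
              J-end = solve (c′ ⨾ h ⨾ g ⨾ ∎)
              J~Y : at P J ~ at P Y
              J~Y = ~-sym (subst₂ _~_ (low Y (trans Y-end (sym t≡′))) (low J (trans J-end (sym t≡′))) (proj₂ c))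
              Y<t : suc Y ≡ t
              Y<t = trans Y-end (sym t≡′)
              Y≤m = ≤-trans (≤-trans (n≤1+n Y) (≤-reflexive Y<t)) (proj₁ tight)
              c+b+r : suc c′ + (b + r) ≡ b + (suc c′ + r)
              c+b+r = solve (c′ ⨾ b ⨾ r ⨾ ∎)
              b+r : b + r ≡ h + suc g
              b+r = +-cancelˡ-≡ (suc c′) (b + r) (h + suc g) (trans c+b+r (trans eq (+-assoc (suc c′) h (suc g))))
              zc : Chord G P z
              zc = subst (Chord G P) (trans (sym (*-distribʳ-+ 2 b r)) (cong (_* 2) b+r))
                (even (halfShort-∸ P (suc c′) r sc sE))
              J<Y : J < Y
              J<Y = lin (c′ * 2 + h * 2 + 1) (z≤n {0}) (solve (c′ ⨾ h ⨾ g ⨾ ∎))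
              short₁ : HalfShort (suc (g + c′))
              short₁ = theta G P {J} {Y} {z} (suc (c′ * 2)) Y≤m (proj₁ zc) J<Y (lin (h * 2) (z≤n {0}) (solve (h ⨾ g ⨾ ∎)))
                J~Y (proj₂ zc) (inj₁ (solve (c′ ⨾ h ⨾ g ⨾ ∎))) (suc (g + c′)) (solve (c′ ⨾ g ⨾ ∎))
              short₂ : HalfShort (suc g)
              short₂ = theta G P {J} {Y} {t} 1 Y≤m (proj₁ tight) J<Y (≤-trans (m≤n⇒m≤1+n J<Y) (≤-reflexive Y<t))
                J~Y (proj₂ tight) (inj₂ (trans (+-comm Y 1) Y<t)) (suc g) (+-comm J 1)
          in c′≢0 (finish g short₂ short₁)
        dichotomy : ∀ a → Chord G R (a * 2) → a ≤ c′ ⊎ a ≡ b + E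
        dichotomy a c with a ≤? c′
        ... | yes a≤c′ = inj₁ a≤c′
        ... | no a≰c′ with m≤n⇒∃[o]m+o≡n (≰⇒> a≰c′)
                         | m≤n⇒m<n∨m≡n (*-cancelʳ-≤ a (b + E) 2 (subst (a * 2 ≤_) t≡ (tmax R c)))
        ...   | _ | inj₂ eq = inj₂ eq
        ...   | h , refl | inj₁ a< with m≤n⇒∃[o]m+o≡n a<
        ...     | g , eq = contradiction c (claim h g (trans (sym eq) (sym (+-suc (suc c′ + h) g))))
        close-evens : ∀ a a′ → a ≤ a′ → a′ ≤ c′ → Chord G R (a * 2) → Chord G R (a′ * 2) → a ≡ a′
        close-evens a a′ a≤a′ a′≤c′ ca ca′ with m≤n⇒∃[o]m+o≡n a≤a′
        ... | zero  , refl = sym (+-identityʳ a)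
        ... | suc r , refl = absurd a (a′≤c′ ⊕ c-min r (even-difference R a (suc r) ca ca′)) (solve (a ⨾ r ⨾ c′ ⨾ ∎))
        small : Dec (∃ λ a → a < suc c′ × Chord G R (a * 2))
        small = anyUpTo? (λ a → chord? G R (a * 2)) (suc c′)
        W : List ℕ
        W with small
        ... | yes (a , _) = a * 2 ∷ (b + E) * 2 ∷ []
        ... | no _        = (b + E) * 2 ∷ []
        W≤2 : length W ≤ 2
        W≤2 with small
        ... | yes (a , _) = ≤-refl
        ... | no _        = s≤s z≤n
        cover : ∀ a → Chord G R (a * 2) → a * 2 ∈ W
        cover a c with small | dichotomy a c
        ... | yes _ | inj₂ refl = there (here refl)
        ... | no _  | inj₂ refl = here refl
        ... | no none | inj₁ a≤ = contradiction (a , s≤s a≤ , c) none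
        ... | yes (a₀ , s≤s a₀≤ , c₀) | inj₁ a≤ with ≤-total a₀ a
        ...   | inj₁ a₀≤a = here (cong (_* 2) (sym (close-evens a₀ a a₀≤a a≤ c₀ c)))
        ...   | inj₂ a≤a₀ = here (cong (_* 2) (close-evens a a₀ a≤a₀ a₀≤ c c₀))

    -- Once the least positive element of the halved S is 1, subtracting 1 repeatedly shows that it
    -- is {0, ..., E}. Counting even cycle lengths then gives `E = k`.
    consecutive : (∀ q → HalfShort q → q ≤ k) × ℓₑ G ≡ 2 + k * 2
    consecutive with least (λ q → short? G (suc q * 2)) (proj₁ shortEven) (proj₂ shortEven)
    ... | c′ , sc , c-min with greatest (λ q → short? G (q * 2)) n (λ {q} s → ≤-trans (m≤m*n q 2) (short-bound G s))
          {suc c′} sc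
    ... | E , sE , E-max =
      (λ q s → ≤-trans (E-max s) E≤k) ,
      ≤-antisym (max≤v⁺ z≤n (All.tabulate below))
                (v≤max⁺ 0 L (inj₂ (Any.map (λ { refl → ≤-refl }) attained)))
      where
      open Progression c′ sc (λ q s → c-min s) E sE (λ q s → E-max s)
      one : HalfShort 1
      one with full P
      ... | inj₁ odd  = subst (λ c → HalfShort (suc c)) (oddCase odd) sc
      ... | inj₂ even = subst (λ c → HalfShort (suc c)) (evenCase even) sc
      down : ∀ r q → HalfShort (r + q) → HalfShort q
      down zero    q s = s
      down (suc r) q s = down r q (halfShort-∸ P 1 (r + q) one s)
      all : ∀ {q} → q ≤ E → HalfShort q
      all {q} q≤E = down (E ∸ q) q (subst HalfShort (sym (m∸n+n≡m q≤E)) sE)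
      f : ℕ → ℕ
      f q = 2 + suc q * 2
      L = evenCycleLengths G
      ∈L⇒ : ∀ {x} → x ∈ L → ∃ λ q → x ≡ f q × suc q ≤ E
      ∈L⇒ {x} x∈ with even-length G (Equivalence.to (∈-evenCycleLengths G {m = x}) x∈)
      ... | q , x≡ , s = q , x≡ , E-max s
      ⇒∈L : ∀ {q} → q < E → f q ∈ L
      ⇒∈L {q} q<E = Equivalence.from (∈-evenCycleLengths G) (short-length G {q} (all q<E))
      len : length L ≡ k
      len = trans ∣Lₑ∣≡l l≡k
      E≤k : E ≤ k
      E≤k = subst₂ _≤_ (length-applyUpTo f E) len (Unique-⊆-length
        (Unique.applyUpTo⁺₁ f E λ i<j _ eq → <⇒≢ i<j (suc-injective (*-cancelʳ-≡ _ _ 2 (suc-injective (suc-injective eq)))))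
        λ x∈ → let q , q<E , x≡ = ∈-applyUpTo⁻ f x∈ in subst (_∈ L) (sym x≡) (⇒∈L q<E))
      k≤E : k ≤ E
      k≤E = subst₂ _≤_ len (length-applyUpTo f E) (Unique-⊆-length
        (Unique.filter⁺ (Lₑ? G) (Unique.upTo⁺ (suc n)))
        λ x∈ → let q , x≡ , q<E = ∈L⇒ x∈ in subst (_∈ applyUpTo f E) (sym x≡) (∈-applyUpTo⁺ f q<E))
      below : ∀ {x} → x ∈ L → x ≤ 2 + k * 2
      below x∈ with ∈L⇒ x∈
      ... | q , refl , q<E = s≤s (s≤s (*-monoˡ-≤ 2 (≤-trans q<E E≤k)))
      attained : 2 + k * 2 ∈ L
      attained = subst (λ j → 2 + j * 2 ∈ L) 1+[k-1] (⇒∈L {pred k} (≤-trans (≤-reflexive 1+[k-1]) k≤E))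
        where 1+[k-1] : suc (pred k) ≡ k
              1+[k-1] = suc-pred k {{>-nonZero (≤-trans (s≤s z≤n) k≥3)}}

-- Chords of an end of a longest path reach at most 2k + 2 vertices

module _ {n} (G : Graph n) {m} (longest : ∀ {m′} → Path G m′ → m′ ≤ m)
         κ (deg : ∀ v → 2 * (3 + κ) + 1 ≤ degree G v)
         (short≤ : ∀ q → Short G (q * 2) → q ≤ 3 + κ)
         {t} (tmax : ∀ (Q : Path G m) {i} → Chord G Q i → i ≤ t) where
  open Graph G
  open Path
  open Longest G longest (3 + κ) deg (∣Lₑ∣ G) refl

  -- There are no more candidates than the degree demands, so none can be left out.
  fill : ∀ (P : Path G m) {u w} U W → length U ≤ u → length W ≤ w → u + w ≤ 2 * (3 + κ) + 1 →
    (∀ a → Chord G P (suc (a * 2)) → suc (a * 2) ∈ U) → (∀ a → Chord G P (a * 2) → a * 2 ∈ W) →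
    (∀ {i} → i ∈ U → Chord G P i) × (∀ {i} → i ∈ W → Chord G P i)
  fill P {u} {w} U W |U| |W| bound odd even with All.all? (chord? G P) U | All.all? (chord? G P) W
  ... | yes allU | yes allW = All.lookup allU , All.lookup allW
  ... | no ¬allU | _ = contradiction
    (≤-trans (s≤s (parity-bound P (filter (chord? G P) U) W ≤-refl |W|
      (λ a c → ∈-filter⁺ (chord? G P) (odd a c) c) even))
      (≤-trans (+-monoˡ-≤ w (≤-trans (filter-notAll (chord? G P) U (¬All⇒Any¬ (chord? G P) U ¬allU)) |U|)) bound))
    (<-irrefl refl)
  ... | yes _ | no ¬allW = contradiction
    (≤-trans (s≤s (parity-bound P {u = u} U (filter (chord? G P) W) |U| ≤-refl
      odd (λ a c → ∈-filter⁺ (chord? G P) (even a c) c)))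
      (≤-trans (≤-reflexive (sym (+-suc u _)))
        (≤-trans (+-monoʳ-≤ u (≤-trans (filter-notAll (chord? G P) W (¬All⇒Any¬ (chord? G P) W ¬allW)) |W|)) bound)))
    (<-irrefl refl)

  odd≤ : ∀ (P : Path G m) a → Chord G P (suc (a * 2)) → a ≤ 3 + κ
  odd≤ P a c = short≤ a (short-odd G P a c)

  odd-list : List ℕ
  odd-list = applyUpTo (λ a → suc (a * 2)) (4 + κ)

  odd-list-cover : ∀ (P : Path G m) a → Chord G P (suc (a * 2)) → suc (a * 2) ∈ odd-list
  odd-list-cover P a c = ∈-applyUpTo⁺ (λ a → suc (a * 2)) (s≤s (odd≤ P a c))

  ∈-range : ∀ lo len {a} → lo ≤ a → a < lo + len → a * 2 ∈ applyUpTo (λ j → (lo + j) * 2) len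
  ∈-range lo len lo≤a a< with m≤n⇒∃[o]m+o≡n lo≤a
  ... | j , refl = ∈-applyUpTo⁺ (λ j → (lo + j) * 2) (+-cancelˡ-< lo j len a<)

  -- With k = 3 + κ, this is the case of an even t > 2k + 2, to be refuted.
  module Long u (t≡ : t ≡ (5 + κ + u) * 2) where

    -- Such a path has both chords 3 and 5, so both rotations below apply to it.
    OddFullTight : Set
    OddFullTight = ∃ λ (R : Path G m) → Chord G R t × (∀ a → a ≤ 3 + κ → Chord G R (suc (a * 2)))

    even≤ : ∀ (P : Path G m) a → Chord G P (a * 2) → ∃ λ r → a + r ≡ 5 + κ + u
    even≤ P a c = m≤n⇒∃[o]m+o≡n (*-cancelʳ-≤ a (5 + κ + u) 2 (subst (a * 2 ≤_) t≡ (tmax P c)))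

    -- The cycle x₀ … x_J x_i … x_t.
    across : ∀ (P : Path G m) → Chord G P t → ∀ J a r → a + r ≡ 5 + κ + u → J * 2 < a * 2 →
             at P (J * 2) ~ at P (a * 2) → J + r ≤ 3 + κ
    across P (t≤m , x₀~xₜ) J a r eq J<a J~a = short≤ (J + r)
      (theta G P (r * 2) (≤-trans a≤t t≤m) t≤m J<a (<-≤-trans J<a a≤t) J~a x₀~xₜ (inj₂ a+r) (J + r)
        (sym (*-distribʳ-+ 2 J r)))
      where
      a+r : a * 2 + r * 2 ≡ t
      a+r = trans (sym (*-distribʳ-+ 2 a r)) (trans (cong (_* 2) eq) (sym t≡))
      a≤t : a * 2 ≤ t
      a≤t = ≤-trans (m≤m+n (a * 2) (r * 2)) (≤-reflexive a+r)

    -- The rotation is x₂ x₁ x₀ x₃ .... By `across` its even positions start at `2(3 + u)`, which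
    -- leaves `k` of them besides `k + 1` odd ones, so `fill` applies.
    module Rotate₃ (P : Path G m) (tight : Chord G P t) (c₃ : Chord G P 3) where
      open Rotated (rotation G P c₃) renaming (path to R) public

      even : ∀ a → Chord G R (a * 2) → a * 2 ∈ applyUpTo (λ j → (3 + u + j) * 2) (3 + κ)
      even zero c = contradiction (chord-pos G R c) λ ()
      even (suc zero) c = absurd {_} {_} u (across P tight 0 1 (4 + κ + u) refl (s≤s z≤n)
        (subst₂ _~_ (low {2} 0 refl) (low {0} 2 refl) (~-sym (proj₂ c)))) (solve (κ ⨾ u ⨾ ∎))
      even a@(suc (suc a′)) c with even≤ R a c
      ... | r , eq = ∈-range (3 + u) (3 + κ)
            (lin {3 + u} {a} 0 (≤-reflexive (sym eq) ⊕ bound) (solve (κ ⨾ u ⨾ r ⨾ a′ ⨾ ∎)))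
            (lin {suc a} {3 + u + (3 + κ)} r (≤-reflexive eq) (solve (κ ⨾ u ⨾ r ⨾ a′ ⨾ ∎)))
        where
        bound : 1 + r ≤ 3 + κ
        bound = across P tight 1 a r eq (s≤s (s≤s (s≤s z≤n)))
          (subst₂ _~_ (low {0} 2 refl) (high (s≤s (s≤s (s≤s z≤n)))) (proj₂ c))

      filled = fill R odd-list (applyUpTo (λ j → (3 + u + j) * 2) (3 + κ))
        (≤-reflexive (length-applyUpTo (λ a → suc (a * 2)) (4 + κ)))
        (≤-reflexive (length-applyUpTo (λ j → (3 + u + j) * 2) (3 + κ)))
        (≤-reflexive size) (odd-list-cover R) even
        where size : 4 + κ + (3 + κ) ≡ 2 * (3 + κ) + 1
              size = solve (κ ⨾ ∎)

      R-odd : ∀ a → a ≤ 3 + κ → Chord G R (suc (a * 2))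
      R-odd a a≤ = proj₁ filled (∈-applyUpTo⁺ (λ a → suc (a * 2)) (s≤s a≤))

      R-even : ∀ j → j < 3 + κ → Chord G R ((3 + u + j) * 2)
      R-even j j< = proj₂ filled (∈-applyUpTo⁺ (λ j → (3 + u + j) * 2) j<)

      result : OddFullTight
      result = R , subst (Chord G R) (trans (cong (_* 2) top) (sym t≡)) (R-even (2 + κ) ≤-refl) , R-odd
        where top : 3 + u + (2 + κ) ≡ 5 + κ + u
              top = solve (κ ⨾ u ⨾ ∎)

    -- The rotation is x₄ x₃ x₂ x₁ x₀ x₅ .... Its even candidates are 4 and the `k − 1` from
    -- `2(4 + u)` on, so `fill` applies again. Attaining 4 means x₀ ~ x₄, and by `across` this
    -- forces `u = 0`.
    module Rotate₅ (P : Path G m) (tight : Chord G P t) (c₅ : Chord G P 5) where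
      open Rotated (rotation G P c₅) renaming (path to R)

      even-list : List ℕ
      even-list = 4 ∷ applyUpTo (λ j → (4 + u + j) * 2) (2 + κ)

      even : ∀ a → Chord G R (a * 2) → a * 2 ∈ even-list
      even zero c = contradiction (chord-pos G R c) λ ()
      even (suc zero) c = absurd {_} {_} u (across P tight 1 2 (3 + κ + u) refl (s≤s (s≤s (s≤s z≤n)))
        (subst₂ _~_ (low {2} 2 refl) (low {0} 4 refl) (~-sym (proj₂ c)))) (solve (κ ⨾ u ⨾ ∎))
      even (suc (suc zero)) c = here refl
      even a@(suc (suc (suc a′))) c with even≤ R a c
      ... | r , eq = there (∈-range (4 + u) (2 + κ)
            (lin {4 + u} {a} 0 (≤-reflexive (sym eq) ⊕ bound) (solve (κ ⨾ u ⨾ r ⨾ a′ ⨾ ∎)))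
            (lin {suc a} {4 + u + (2 + κ)} r (≤-reflexive eq) (solve (κ ⨾ u ⨾ r ⨾ a′ ⨾ ∎))))
        where
        bound : 2 + r ≤ 3 + κ
        bound = across P tight 2 a r eq (s≤s (s≤s (s≤s (s≤s (s≤s z≤n)))))
          (subst₂ _~_ (low {0} 4 refl) (high (s≤s (s≤s (s≤s (s≤s (s≤s z≤n)))))) (proj₂ c))

      filled = fill R odd-list even-list
        (≤-reflexive (length-applyUpTo (λ a → suc (a * 2)) (4 + κ)))
        (s≤s (≤-reflexive (length-applyUpTo (λ j → (4 + u + j) * 2) (2 + κ))))
        (≤-reflexive size) (odd-list-cover R) even
        where size : 4 + κ + (3 + κ) ≡ 2 * (3 + κ) + 1
              size = solve (κ ⨾ ∎)

      u≡0 : u ≡ 0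
      u≡0 = n≤0⇒n≡0 (+-cancelˡ-≤ (3 + κ) u 0 (≤-trans
        (across P tight 0 2 (3 + κ + u) refl (s≤s z≤n)
          (subst₂ _~_ (low {4} 0 refl) (low {0} 4 refl) (~-sym (proj₂ (proj₂ filled (here refl))))))
        (≤-reflexive (sym (+-identityʳ (3 + κ))))))

      result : OddFullTight
      result = R , subst (Chord G R) (trans (cong (_* 2) top) (sym t≡))
                    (proj₂ filled (there (∈-applyUpTo⁺ (λ j → (4 + u + j) * 2) {1 + κ} ≤-refl)))
                 , λ a a≤ → proj₁ filled (∈-applyUpTo⁺ (λ a → suc (a * 2)) (s≤s a≤))
        where top : 4 + u + (1 + κ) ≡ 5 + κ + u
              top = solve (κ ⨾ u ⨾ ∎)

    -- Without 3 and 5 there remain `k − 1` odd candidates, and `across` with `J = 0` leaves `k + 1`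
    -- even ones: `2k` in all, one too few.
    three⊎five : ∀ (P : Path G m) → Chord G P t → Chord G P 3 ⊎ Chord G P 5
    three⊎five P tight with chord? G P 3 | chord? G P 5
    ... | yes c₃ | _ = inj₁ c₃
    ... | no _ | yes c₅ = inj₂ c₅
    ... | no ¬c₃ | no ¬c₅ = absurd 0 (parity-bound P odd-list′ even-list
            (s≤s (≤-reflexive (length-applyUpTo (λ a → suc ((3 + a) * 2)) (1 + κ))))
            (≤-reflexive (length-applyUpTo (λ j → (2 + u + j) * 2) (4 + κ))) odd even) (solve (κ ⨾ ∎))
      where
      odd-list′ = 1 ∷ applyUpTo (λ a → suc ((3 + a) * 2)) (1 + κ)
      even-list = applyUpTo (λ j → (2 + u + j) * 2) (4 + κ)
      odd : ∀ a → Chord G P (suc (a * 2)) → suc (a * 2) ∈ odd-list′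
      odd zero c = here refl
      odd (suc zero) c = contradiction c ¬c₃
      odd (suc (suc zero)) c = contradiction c ¬c₅
      odd (suc (suc (suc a))) c = there (∈-applyUpTo⁺ (λ a → suc ((3 + a) * 2)) {i = a} (≤-pred (≤-pred (odd≤ P (3 + a) c))))
      even : ∀ a → Chord G P (a * 2) → a * 2 ∈ even-list
      even a c with even≤ P a c
      ... | r , eq = ∈-range (2 + u) (4 + κ)
            (lin {2 + u} {a} 0 (≤-reflexive (sym eq) ⊕ bound) (solve (κ ⨾ u ⨾ r ⨾ a ⨾ ∎)))
            (lin {suc a} {2 + u + (4 + κ)} r (≤-reflexive eq) (solve (κ ⨾ u ⨾ r ⨾ a ⨾ ∎)))
        where
        bound : r ≤ 3 + κ
        bound = across P tight 0 a r eq (chord-pos G P c) (proj₂ c)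

    oddFullTight : ∀ (P : Path G m) → Chord G P t → OddFullTight
    oddFullTight P tight with three⊎five P tight
    ... | inj₁ c₃ = Rotate₃.result P tight c₃
    ... | inj₂ c₅ = Rotate₅.result P tight c₅

  tight-bound : ∀ (P : Path G m) → Chord G P t → t ≤ 2 + (3 + κ) * 2
  tight-bound P tight with even⊎odd t
  ... | inj₂ (a , refl) = s≤s (m≤n⇒m≤1+n (*-monoˡ-≤ 2 (odd≤ P a tight)))
  ... | inj₁ (a , t≡a) with a ≤? 4 + κ
  ...   | yes a≤ = subst (_≤ _) (sym t≡a) (*-monoˡ-≤ 2 a≤)
  ...   | no  a≰ with m≤n⇒∃[o]m+o≡n (≰⇒> a≰)
  ...     | u , refl = ⊥-elim (impossible (Long.oddFullTight u t≡a P tight))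
    where
    impossible : ¬ Long.OddFullTight u t≡a
    impossible (Q , tight , odd) = <-irrefl refl (short≤ (4 + κ) long)
      where
      open Long u t≡a
      open Rotate₃ Q tight (odd 1 (s≤s z≤n))
      u≡0 : u ≡ 0
      u≡0 = Rotate₅.u≡0 Q tight (odd 2 (s≤s (s≤s z≤n)))
      t≡ : t ≡ (5 + κ) * 2
      t≡ = trans t≡a (cong (_* 2) (trans (cong (5 + κ +_) u≡0) (+-identityʳ (5 + κ))))
      c₆ : Chord G R 6
      c₆ = subst (λ u → Chord G R ((3 + u + 0) * 2)) u≡0 (R-even 0 (s≤s z≤n))
      open Rotated (rotation G R c₆) renaming (path to S; low to low₆; high to high₆)
      6≤t : 6 ≤ t
      6≤t = ≤-trans (m≤m+n 6 (4 + κ * 2)) (≤-reflexive (sym t≡))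
      -- With Q written q₀ q₁ ..., the path S is q₅ q₄ q₃ q₀ q₁ q₂ q₆ .... The edges q₀ q_t and q₂
      -- q₅ give the cycle q₅ q₄ q₃ q₀ q_t ... q₆ q₂ of length `2k + 4`.
      long : Short G ((4 + κ) * 2)
      long = theta G S {3} {t} {5} (suc ((2 + κ) * 2)) (proj₁ tight) (≤-trans (m≤n+m 5 1) (proj₁ c₆))
        (≤-trans (s≤s (s≤s (s≤s (s≤s z≤n)))) 6≤t) (s≤s (s≤s (s≤s (s≤s z≤n))))
        (subst₂ _~_ (sym (trans (low₆ {3} 2 refl) (low {2} 0 refl)))
          (sym (trans (high₆ 6≤t) (high (≤-trans (s≤s (s≤s (s≤s z≤n))) 6≤t)))) (proj₂ tight))
        (subst₂ _~_ (sym (low₆ {0} 5 refl)) (sym (low₆ {5} 0 refl)) (~-sym (proj₂ (R-odd 2 (s≤s (s≤s z≤n))))))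
        (inj₁ (sym t≡)) (4 + κ) refl

-- The order is at most 2k + 3

module _ {n} (G : Graph n) {m} (longest : ∀ {m′} → Path G m′ → m′ ≤ m)
         k (k≥3 : 3 ≤ k) (deg : ∀ v → 2 * k + 1 ≤ degree G v)
         {t} (tmax : ∀ (Q : Path G m) {i} → Chord G Q i → i ≤ t)
         (t≤ : t ≤ 2 + 2 * k) (P : Path G m) (tight : Chord G P t) where
  open Graph G
  open Path
  open Longest G longest k deg (∣Lₑ∣ G) refl

  positions : List ℕ
  positions = applyUpTo suc t

  positions-cover : ∀ (Q : Path G m) {i} → Chord G Q i → i ∈ positions
  positions-cover Q {zero}  c = contradiction (chord-pos G Q c) λ ()
  positions-cover Q {suc i} c = ∈-applyUpTo⁺ suc (tmax Q c)

  2k+1≤t : 2 * k + 1 ≤ t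
  2k+1≤t = ≤-trans (degree-bound P positions (positions-cover P)) (≤-reflexive (length-applyUpTo suc t))

  -- At most `2k + 2` positions are available and `2k + 1` of them are needed.
  one-missing : ∀ (Q : Path G m) {g} → 0 < g → g ≤ t → ¬ Chord G Q g →
                ∀ {i} → 0 < i → i ≤ t → g ≢ i → Chord G Q i
  one-missing Q {suc g} _ g≤t ¬g {suc i} _ i≤t g≢i = decidable-stable (chord? G Q (suc i)) λ ¬i →
    absurd 0 (degree-bound Q (filter (chord? G Q) positions) (λ c → ∈-filter⁺ (chord? G Q) (positions-cover Q c) c)
      ⊕ ≤-trans (two-missing (chord? G Q) (Unique.applyUpTo⁺₁ suc t λ i<j _ eq → <⇒≢ i<j (suc-injective eq))
          (∈-applyUpTo⁺ suc g≤t) (∈-applyUpTo⁺ suc i≤t) g≢i ¬g ¬i) (≤-reflexive (length-applyUpTo suc t))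
      ⊕ t≤) (arith k t (length (filter (chord? G Q) positions)))
    where
    arith : ∀ k t f → 2 * k + 1 + (2 + f + t) ≡ suc (f + (t + (2 + 2 * k)) + 0)
    arith k t f = solve (k ⨾ t ⨾ f ⨾ ∎)

  Within : Path G m → Set
  Within Q = ∀ {i} → i ≤ t → ∃ λ j → j ≤ t × at Q i ≡ at P j

  Closed : Fin n → Set
  Closed v = ∀ {w} → v ~ w → ∃ λ j → j ≤ t × w ≡ at P j

  closed : ∀ Q → Within Q → Closed (at Q 0)
  closed Q within v~w with neighbour-on-path Q v~w
  ... | i , c , refl = within (tmax Q c)

  -- A chord has position at most `t`, so rotating there only permutes the vertices before position
  -- `t`.
  within-rotation : ∀ Q {p} → Within Q → (c : Chord G Q p) → Within (Rotated.path (rotation G Q c))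
  within-rotation Q {p} within c {i} i≤t with <-≤-connex i p
  ... | inj₂ p≤i with within i≤t
  ...   | j , j≤t , eq = j , j≤t , trans (Rotated.high (rotation G Q c) p≤i) eq
  within-rotation Q {p} within c {i} i≤t | inj₁ i<p with m≤n⇒∃[o]m+o≡n i<p
  ... | j , eq with within {j} (≤-trans (≤-trans (m≤n+m j (suc i)) (≤-reflexive eq)) (tmax Q c))
  ...   | j′ , j′≤t , eq′ = j′ , j′≤t , trans (Rotated.low (rotation G Q c) j (trans (+-suc i j) eq)) eq′

  P-within : Within P
  P-within i≤t = _ , i≤t , refl

  7≤t : 7 ≤ t
  7≤t = ≤-trans (+-monoˡ-≤ 1 (*-monoʳ-≤ 2 k≥3)) 2k+1≤t

  -- If `v + 1` is a chord, rotating there makes x_v an end. Otherwise it is the only missing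
  -- position, and all other chords are at hand.
  all-closed : ∀ v → v < t → Closed (at P v)
  all-closed v v<t with chord? G P (suc v)
  ... | yes c = subst Closed (low {0} v refl) (closed R (within-rotation P P-within c))
    where open Rotated (rotation G P c) renaming (path to R)
  ... | no ¬c = missing v v<t ¬c
    where
    others : ∀ {v} → v < t → ¬ Chord G P (suc v) → ∀ {i} → 0 < i → i ≤ t → suc v ≢ i → Chord G P i
    others v<t ¬c = one-missing P (s≤s z≤n) v<t ¬c
    -- No rotation of P starts at x_v, but a rotation of a rotation does.
    missing : ∀ v → v < t → ¬ Chord G P (suc v) → Closed (at P v)
    missing zero v<t ¬c = contradiction (chord-one G P tight) ¬c
    missing (suc zero) v<t ¬c = subst Closed (trans (low₃ {0} 2 refl) (low₄ {2} 1 refl))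
                                  (closed S (within-rotation R (within-rotation P P-within c₄) c₃))
      where
      -- R is x₃ x₂ x₁ x₀ x₄ ..., and S is x₁ x₂ x₃ x₀ x₄ ....
      c₄ : Chord G P 4
      c₄ = others v<t ¬c (s≤s z≤n) (≤-trans (s≤s (s≤s (s≤s (s≤s z≤n)))) 7≤t) λ ()
      open Rotated (rotation G P c₄) renaming (path to R; low to low₄)
      c₃ : Chord G R 3
      c₃ = ≤-trans (n≤1+n 3) (proj₁ c₄) , subst₂ _~_ (sym (low₄ {0} 3 refl)) (sym (low₄ {3} 0 refl))
             (~-sym (proj₂ (others v<t ¬c (s≤s z≤n) (≤-trans (s≤s (s≤s (s≤s z≤n))) 7≤t) λ ())))
      open Rotated (rotation G R c₃) renaming (path to S; low to low₃)
    missing v@(suc (suc v′)) v<t ¬c = subst Closed (trans (lowg {0} v refl) (high₂ (s≤s (s≤s z≤n))))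
                                  (closed S (within-rotation R (within-rotation P P-within c₂) cg))
      where
      g = suc v
      g<t : g < t
      g<t = ≤∧≢⇒< v<t λ { refl → ¬c tight }
      c₂ : Chord G P 2
      c₂ = others v<t ¬c (s≤s z≤n) (≤-trans (s≤s (s≤s z≤n)) 7≤t) λ ()
      open Rotated (rotation G P c₂) renaming (path to R; low to low₂; high to high₂)
      -- Q starts at x_g and has x₀ at position `g`. As x_g and x₀ are not adjacent, this is the one
      -- position Q misses, so x_g ~ x₁. Hence `g` is a chord of R, which is x₁ x₀ x₂ ..., and
      -- rotating there puts x_v first.
      c₊ : Chord G P (suc g)
      c₊ = others v<t ¬c (s≤s z≤n) g<t (<⇒≢ ≤-refl)
      open Rotated (rotation G P c₊) renaming (path to Q; low to low₊)
      ¬g : ¬ Chord G Q g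
      ¬g (g≤m , x) = ¬c (g≤m , ~-sym (subst₂ _~_ (low₊ {0} g refl) (low₊ {g} 0 (+-comm g 1)) x))
      cg : Chord G R g
      cg = ≤-trans v<t (proj₁ tight) ,
           subst₂ _~_ (sym (low₂ {0} 1 refl)) (sym (high₂ (s≤s (s≤s z≤n))))
             (~-sym (subst₂ _~_ (low₊ {0} g refl) (low₊ {v} 1 (+-comm v 2))
               (proj₂ (one-missing Q (s≤s z≤n) v<t ¬g {v} (s≤s z≤n) (<⇒≤ v<t) (<⇒≢ ≤-refl ∘ sym)))))
      open Rotated (rotation G R cg) renaming (path to S; low to lowg)

  -- A walk from x₀ that avoids x_t never leaves x₀ ... x_{t-1}, by `all-closed`. As x_t is not a
  -- cut vertex, such walks reach every other vertex.
  covers : KConnected G 2 → ∀ w → ∃ λ j → j ≤ t × w ≡ at P j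
  covers (_ , connected) w with w Fin.≟ at P t
  ... | yes refl = t , ≤-refl , refl
  ... | no w≢xₜ with walk 0 0<t (connected ⁅ at P t ⁆ (s≤s (≤-reflexive (Subset.∣⁅x⁆∣≡1 (at P t))))
                              (Subset.x≢y⇒x∉⁅y⁆ x₀≢xₜ) (Subset.x≢y⇒x∉⁅y⁆ w≢xₜ))
    where
    0<t = chord-pos G P tight
    x₀≢xₜ : at P 0 ≢ at P t
    x₀≢xₜ eq = <⇒≢ 0<t (injective P z≤n (proj₁ tight) eq)
    walk : ∀ i → i < t → ∀ {w} → Star (λ x y → x Subset.∉ ⁅ at P t ⁆ × y Subset.∉ ⁅ at P t ⁆ × x ~ y) (at P i) w →
           ∃ λ j → j ≤ t × w ≡ at P j
    walk i i<t ε = i , <⇒≤ i<t , refl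
    walk i i<t ((_ , y∉ , x~y) ◅ rest) with all-closed i i<t x~y
    ... | j , j≤t , refl = walk j (≤∧≢⇒< j≤t λ { refl → y∉ (Subset.x∈⁅x⁆ (at P t)) }) rest
  ... | found = found

  order-bound : KConnected G 2 → n ≤ suc t
  order-bound conn = subst₂ _≤_ (length-tabulate id) (trans (length-map (at P) (upTo (suc t))) (length-applyUpTo id (suc t)))
    (Unique-⊆-length {ys = map (at P) (upTo (suc t))} (Unique.allFin⁺ n) λ {w} _ → let j , j≤t , eq = covers conn w in
      subst (_∈ map (at P) (upTo (suc t))) (sym eq) (∈-map⁺ (at P) (∈-upTo⁺ (s≤s j≤t))))

-- Cliques and colourings

module _ {n} (G : Graph n) where
  open Graph G
  open Path

  δ≤degree : ∀ v → δ G ≤ degree G v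
  δ≤degree v = All.lookup (min≤xs n (map (degree G) (allFin n))) (∈-map⁺ (degree G) (∈-allFin v))

  non-neighbours : ∀ {v} {xs : List (Fin n)} → Unique xs → (∀ {x} → x ∈ xs → ¬ (v ~ x)) → length xs + degree G v ≤ n
  non-neighbours {v} {xs} u xs∌ = ≤-trans (+-monoʳ-≤ (length xs) (∣p∣≤length (neighbours G v) nbrs
      λ {x} x∈ → ∈-filter⁺ (v ~?_) (∈-allFin x) (∈-neighbours⁻ G x∈)))
    (≤-trans (≤-reflexive (sym (length-++ xs))) (≤-trans (Unique-⊆-length {ys = allFin n}
      (Unique.++⁺ u (Unique.filter⁺ (v ~?_) (Unique.allFin⁺ n))
        λ (x∈ , x∈′) → xs∌ x∈ (proj₂ (∈-filter⁻ (v ~?_) {xs = allFin n} x∈′)))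
      λ {x} _ → ∈-allFin x) (≤-reflexive (length-tabulate id))))
    where nbrs = filter (v ~?_) (allFin n)

  NonAdjacent : Fin n → Fin n → Set
  NonAdjacent a b = a ≢ b × ¬ (a ~ b)

  nonAdjacent? : ∀ a b → Dec (NonAdjacent a b)
  nonAdjacent? a b = ¬? (a Fin.≟ b) ×-dec ¬? (a ~? b)

  adjacent : ∀ {a b} → ¬ NonAdjacent a b → a ≢ b → a ~ b
  adjacent {a} {b} ¬na a≢b = decidable-stable (a ~? b) λ ¬a~b → ¬na (a≢b , ¬a~b)

  delete-clique : ∀ c → n ≡ suc c → (a : Fin n) → (∀ {u v} → u ≢ a → v ≢ a → u ≢ v → u ~ v) → HasComplete G c
  delete-clique c refl a clique = Subset.∁ ⁅ a ⁆ ,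
    (λ u∈ v∈ → clique (Subset.x∉⁅y⁆⇒x≢y (Subset.x∈∁p⇒x∉p u∈)) (Subset.x∉⁅y⁆⇒x≢y (Subset.x∈∁p⇒x∉p v∈))) ,
    trans (Subset.∣∁p∣≡n∸∣p∣ ⁅ a ⁆) (cong (n ∸_) (Subset.∣⁅x⁆∣≡1 a))

-- Merge `q` into `p` and `s` into `r`. Then neither `q` nor `s` is a representative, and removing
-- both by `punchOut` leaves `c` colours.
colour-two-pairs : ∀ {c} (G : Graph (2 + c)) {p q r s} → NonAdjacent G p q → NonAdjacent G r s →
                   r ≢ p → s ≢ p → q ≢ r → q ≢ s → Colourable G c
colour-two-pairs {c} G {p} {q} {r} {s} (p≢q , p≁q) (r≢s , r≁s) r≢p s≢p q≢r q≢s =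
  Vec.tabulate colour , λ u v u~v eq →
    proper u~v (merge u) (merge v) (same u v (trans (sym (lookup∘tabulate colour u)) (trans eq (lookup∘tabulate colour v))))
  where
  open Graph G
  data Merge (v : Fin (2 + c)) : Fin (2 + c) → Set where
    isq   : v ≡ q → Merge v p
    iss   : v ≡ s → Merge v r
    other : v ≢ q → v ≢ s → Merge v v
  rep : Fin (2 + c) → Fin (2 + c)
  rep v with v Fin.≟ q | v Fin.≟ s
  ... | yes _ | _     = p
  ... | no _  | yes _ = r
  ... | no _  | no _  = v
  merge : ∀ v → Merge v (rep v)
  merge v with v Fin.≟ q | v Fin.≟ s
  ... | yes v≡q | _       = isq v≡q
  ... | no _    | yes v≡s = iss v≡s
  ... | no v≢q  | no v≢s  = other v≢q v≢s
  q≢rep : ∀ {v w} → Merge v w → q ≢ w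
  q≢rep (isq _)       = p≢q ∘ sym
  q≢rep (iss _)       = q≢r
  q≢rep (other v≢q _) = v≢q ∘ sym
  s≢rep : ∀ {v w} → Merge v w → s ≢ w
  s≢rep (isq _)       = s≢p
  s≢rep (iss _)       = r≢s ∘ sym
  s≢rep (other _ v≢s) = v≢s ∘ sym
  s≢rep′ : ∀ v → punchOut q≢s ≢ punchOut (q≢rep (merge v))
  s≢rep′ v eq = s≢rep (merge v) (Fin.punchOut-injective q≢s (q≢rep (merge v)) eq)
  colour : Fin (2 + c) → Fin c
  colour v = punchOut (s≢rep′ v)
  same : ∀ u v → colour u ≡ colour v → rep u ≡ rep v
  same u v eq = Fin.punchOut-injective (q≢rep (merge u)) (q≢rep (merge v))
                  (Fin.punchOut-injective (s≢rep′ u) (s≢rep′ v) eq)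
  proper : ∀ {u v x y} → u ~ v → Merge u x → Merge v y → x ≢ y
  proper u~v (isq refl)  (isq refl)  _    = ~-irrefl refl u~v
  proper u~v (isq refl)  (iss refl)  p≡r  = r≢p (sym p≡r)
  proper u~v (isq refl)  (other _ _) refl = p≁q (~-sym u~v)
  proper u~v (iss refl)  (isq refl)  r≡p  = r≢p r≡p
  proper u~v (iss refl)  (iss refl)  _    = ~-irrefl refl u~v
  proper u~v (iss refl)  (other _ _) refl = r≁s (~-sym u~v)
  proper u~v (other _ _) (isq refl)  refl = p≁q u~v
  proper u~v (other _ _) (iss refl)  refl = r≁s u~v
  proper u~v (other _ _) (other _ _) refl = ~-irrefl refl u~v

-- `χ` searches only below its default value `n`, whence `c < n`.
colourable⇒χ≤ : ∀ {n c} (G : Graph n) → c < n → Colourable G c → χ G ≤ c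
colourable⇒χ≤ {n} G c<n col = min≤v⁺ n (filter (colourable? G) (upTo n))
  (inj₂ (Any.map (λ { refl → ≤-refl }) (∈-filter⁺ (colourable? G) (∈-upTo⁺ c<n) col)))

-- For `n = c + 2` every vertex has at most one non-neighbour besides itself. Either deleting one
-- vertex leaves a clique, or two disjoint non-adjacent pairs exist and can be merged.
small-order : ∀ c {n} (G : Graph n) → 0 < n → (∀ v → c ≤ degree G v) → n ≤ 2 + c →
              HasComplete G (suc c) ⊎ χ G ≤ c
small-order c {n@(suc n′)} G _ deg n≤ with m≤n⇒m<n∨m≡n n≤
... | inj₁ (s≤s n≤1+c) = inj₁ (Subset.⊤ , (λ {u} {v} _ _ → adjacent G λ (u≢v , u≁v) → <-irrefl refl
        (≤-trans (+-monoʳ-≤ 2 (deg u)) (≤-trans (non-neighbours G ((u≢v ∷ []) ∷ [] ∷ [])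
          λ { (here refl) → Graph.~-irrefl G refl ; (there (here refl)) → u≁v }) n≤1+c))) ,
        trans (Subset.∣⊤∣≡n n) (≤-antisym n≤1+c (≤-trans (s≤s (deg Fin.zero))
          (non-neighbours G {xs = Fin.zero ∷ []} ([] ∷ []) λ { (here refl) → Graph.~-irrefl G refl }))))
... | inj₂ refl with Fin.any? (λ p → Fin.any? (λ q → nonAdjacent? G p q))
...   | no none = inj₁ (delete-clique G (suc c) refl Fin.zero λ _ _ → adjacent G λ na → none (_ , _ , na))
...   | yes (p , q , na) with Fin.any? (λ r → Fin.any?
    (λ s → (¬? (r Fin.≟ p) ×-dec ¬? (s Fin.≟ p)) ×-dec nonAdjacent? G r s))
...     | no none = inj₁ (delete-clique G (suc c) refl p λ r≢ s≢ → adjacent G λ na → none (_ , _ , (r≢ , s≢) , na))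
...     | yes (r , s , (r≢p , s≢p) , na′) = inj₂ (colourable⇒χ≤ G (s≤s (n≤1+n c))
            (colour-two-pairs G na na′ r≢p s≢p (λ { refl → lonely na′ s≢p })
              (λ { refl → lonely (proj₁ na′ ∘ sym , proj₂ na′ ∘ Graph.~-sym G) r≢p })))
  where
  -- Here `q` would have the three distinct non-neighbours `q`, `x` and `p`, which its degree
  -- excludes. This makes the two pairs disjoint.
  lonely : ∀ {x} → NonAdjacent G q x → x ≢ p → ⊥
  lonely (q≢x , q≁x) x≢p = <-irrefl refl (≤-trans (+-monoʳ-≤ 3 (deg q))
    (non-neighbours G ((q≢x ∷ proj₁ na ∘ sym ∷ []) ∷ (x≢p ∷ []) ∷ [] ∷ [])
      λ { (here refl) → Graph.~-irrefl G refl ; (there (here refl)) → q≁x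
        ; (there (there (here refl))) → proj₂ na ∘ Graph.~-sym G }))

-- Choice of the extremal path, and conclusion

module _ {n} (G : Graph n) (0<n : 0 < n) k (deg : ∀ v → 2 * k + 1 ≤ degree G v) where
  open Path

  trivial-path : Path G 0
  trivial-path = record { at = λ _ → fromℕ< 0<n ; injective = λ { z≤n z≤n _ → refl } ; step = λ () }

  -- The length `m` is maximised first, then `t` over all paths of that length.
  by-extremal-path : ∀ {X : Set} → Dec X →
    (∀ {m} → (∀ {m′} → Path G m′ → m′ ≤ m) → ∀ {t} → (∀ (Q : Path G m) {i} → Chord G Q i → i ≤ t) →
     ∀ (P : Path G m) → Chord G P t → X) → X
  by-extremal-path X? extremal = decidable-stable X? λ ¬x →
    ¬¬-maximum {A = ∃ (Path G)} proj₁ n (λ (_ , P) → <⇒≤ (path-short G P)) (0 , trivial-path) λ ((m , P) , longest) →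
    let open Longest G (λ {m′} Q → longest (m′ , Q)) k deg (∣Lₑ∣ G) refl
        Chorded = ∃ λ (Q : Path G m) → ∃ (Chord G Q)
        -- The degree is positive, so the second maximum is taken over a non-empty family.
        none→⊥ : ¬ ¬ Chorded
        none→⊥ none = absurd (2 * k) (degree-bound P [] λ c → contradiction (P , _ , c) none) (+-comm (2 * k) 1)
    in none→⊥ λ chorded →
    ¬¬-maximum {A = Chorded} (proj₁ ∘ proj₂) m (λ (_ , _ , c) → proj₁ c) chorded λ ((Q , t , c) , tmax) →
    ¬x (extremal (λ {m′} Q → longest (m′ , Q)) (λ R cR → tmax (R , _ , cR)) Q c)

theorem8 : ∀ (k : ℕ) → k ≥ 3 → ∀ {n : ℕ} (G : Graph n) →
    KConnected G 2 → δ G ≥ 2 * k + 1 →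
    (∣Lₑ∣ G ≥ k) ×
    (∣Lₑ∣ G ≡ k →
    (2 * ∣Lₑ∣ G + 2 ≡ ℓₑ G) × (HasComplete G (2 * k + 2) ⊎ χ G ≤ 2 * k + 1))
theorem8 k k≥3 {n} G conn@(2<n , _) δ≥ =
  by-extremal-path G 0<n k deg (k ≤? ∣Lₑ∣ G)
    (λ longest _ P _ → Longest.enough G longest k deg (∣Lₑ∣ G) refl P) ,
  λ ∣Lₑ∣≡k → let even , order = extremal ∣Lₑ∣≡k in even , order
  where
  0<n = ≤-trans (s≤s z≤n) 2<n
  deg : ∀ v → 2 * k + 1 ≤ degree G v
  deg v = ≤-trans δ≥ (δ≤degree G v)
  extremal : ∣Lₑ∣ G ≡ k → (2 * ∣Lₑ∣ G + 2 ≡ ℓₑ G) × (HasComplete G (2 * k + 2) ⊎ χ G ≤ 2 * k + 1)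
  extremal ∣Lₑ∣≡k with m≤n⇒∃[o]m+o≡n k≥3
  ... | κ , refl = trans (cong (λ l → 2 * l + 2) ∣Lₑ∣≡k) (trans (arith κ) (sym (proj₁ facts))) ,
        subst (λ c → HasComplete G c ⊎ χ G ≤ 2 * (3 + κ) + 1) (sym (+-suc (2 * (3 + κ)) 1))
          (small-order (2 * (3 + κ) + 1) G 0<n deg (proj₂ facts))
    where
    arith : ∀ κ → 2 * (3 + κ) + 2 ≡ 2 + (3 + κ) * 2
    arith κ = solve (κ ⨾ ∎)
    facts : ℓₑ G ≡ 2 + (3 + κ) * 2 × n ≤ 2 + (2 * (3 + κ) + 1)
    facts = by-extremal-path G 0<n (3 + κ) deg (ℓₑ G ≟ _ ×-dec n ≤? _) λ longest tmax P tight →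
      let halfShort≤k , longestEven = Tight.consecutive G longest (3 + κ) k≥3 deg (∣Lₑ∣ G) refl ∣Lₑ∣≡k P tight tmax
          t≤ = tight-bound G longest κ deg halfShort≤k tmax P tight
          t≤′ = ≤-trans t≤ (≤-reflexive (cong (2 +_) (*-comm (3 + κ) 2)))
      in longestEven , ≤-trans (order-bound G longest (3 + κ) k≥3 deg tmax t≤′ P tight conn)
           (≤-trans (s≤s t≤′) (≤-reflexive (cong (2 +_) (sym (+-comm (2 * (3 + κ)) 1)))))
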